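{- A finite simple graph $G$ is $\{P_5,\overline{P_5}\}$-free if and only if at least one of the following holds: (a) $G$ is a split graph; (b) $G$ is a pentagon (isomorphic to $C_5$); (c) $G$ is obtained by substitution from smaller $\{P_5,\overline{P_5}\}$-free graphs; (d) $G$ or $\overline{G}$ is obtained by split unification from smaller $\{P_5,\overline{P_5}\}$-free graphs.
   Context: $P_5$ is the path on 5 vertices, $C_5$ the 5-cycle, $\overline{G}$ the complement of $G$. A graph is $\{P_5,\overline{P_5}\}$-free if it has no induced subgraph isomorphic to $P_5$ or to $\overline{P_5}$. A graph is split if its vertex set can be partitioned into a clique and a stable set. Substitution: given vertex-disjoint graphs $G_0$ and $H$ and a vertex $x$ of $G_0$, the graph obtained by substituting $H$ for $x$ has vertex set $V(G_0\setminus x)\cup V(H)$, consists of the union of $G_0\setminus x$ and $H$, plus all edges between $V(H)$ and the neighbors of $x$ in $G_0$. "$G$ is obtained by substitution from smaller graphs in a class" means $G$ is isomorphic to such a graph where $G_0$ and $H$ both have fewer vertices than $G$ (equivalently, both have at least two vertices) and both lie in the class. For $S\subseteq V(G)$ and $v\notin S$: $v$ is complete to $S$ if adjacent to all of $S$, anticomplete if adjacent to none, mixed on $S$ otherwise; a set is complete (anticomplete) to a disjoint set if each of its vertices is. An anticomponent of $S$ is a subset of $S$ inducing a connected component of the complement of $G[S]$. Composable pair: let $A,B,C,L,T$ be pairwise disjoint sets with $A,C$ non-empty, and $a^*,c^*$ two distinct vertices not in $A\cup B\cup C\cup L\cup T$. $G_1$ is a graph on $A\cup B\cup L\cup T\cup\{c^*\}$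 such that $L$ is a (possibly empty) clique, $T$ is a (possibly empty) stable set, $A$ is complete to $B$ and anticomplete to $T$, some vertex of $A$ is complete to $L$, and $c^*$ is complete to $B\cup L$ and anticomplete to $A\cup T$ (other adjacencies arbitrary). $G_2$ is a graph on $B\cup C\cup L\cup T\cup\{a^*\}$ such that $G_2[B\cup L\cup T]=G_1[B\cup L\cup T]$, $T$ is anticomplete to $C$, $L$ is complete to $B\cup C$, $a^*$ is complete to $B\cup L$ and anticomplete to $C\cup T$, some vertex of $C$ is complete to $B$, and no vertex of $C$ is mixed on any anticomponent of $B$ (other adjacencies arbitrary). Its split unification is the graph on $A\cup B\cup C\cup L\cup T$ whose restriction to $A\cup B\cup L\cup T$ is $G_1\setminus c^*$, whose restriction to $B\cup C\cup L\cup T$ is $G_2\setminus a^*$, and in which $A$ is anticomplete to $C$. "$G$ is obtained by split unification from smaller graphs in a class" means $G$ is (isomorphic to) the split unification of a composable pair $(G_1,G_2)$ with $G_1,G_2$ in the class and each having fewer vertices than $G$. -}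

module Defs where

open import Data.Nat using (ℕ; zero; suc; _<_; _≡ᵇ_)
open import Data.Bool using (Bool; true; false; not; _∨_; if_then_else_)
open import Data.Fin using (Fin; toℕ; _≟_)
open import Data.Maybe using (Maybe; just; nothing)
open import Data.Product using (Σ; ∃; _×_; _,_)
open import Data.Sum using (_⊎_; inj₁; inj₂)
open import Data.Empty using (⊥-elim)
open import Relation.Nullary using (¬_; does; yes; no)
open import Relation.Binary.PropositionalEquality using (_≡_; _≢_; refl; sym; cong)
open import Function.Bundles using (_↔_; Inverse)
open import Function.Definitions using (Injective)

record Graph (n : ℕ) : Set where
  field
    adj    : Fin n → Fin n → Bool
    adjSym : ∀ u v → adj u v ≡ adj v u
    adjIrr : ∀ v → adj v v ≡ false
open Graph public

compl : ∀ {n} → Graph n → Graph n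
compl {n} G = record { adj = cadj ; adjSym = csym ; adjIrr = cirr }
  where
  cadj : Fin n → Fin n → Bool
  cadj u v = if does (u ≟ v) then false else not (adj G u v)
  csym : ∀ u v → cadj u v ≡ cadj v u
  csym u v with u ≟ v | v ≟ u
  ... | yes _ | yes _ = refl
  ... | yes p | no q = ⊥-elim (q (sym p))
  ... | no p | yes q = ⊥-elim (p (sym q))
  ... | no _ | no _ = cong not (adjSym G u v)
  cirr : ∀ v → cadj v v ≡ false
  cirr v with v ≟ v
  ... | yes _ = refl
  ... | no p = ⊥-elim (p refl)

Iso : ∀ {n} → Graph n → (W : Set) → (W → W → Bool) → Set
Iso {n} G W F = Σ (Fin n ↔ W) λ φ →
  ∀ u v → adj G u v ≡ F (Inverse.to φ u) (Inverse.to φ v)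

P5adj : Fin 5 → Fin 5 → Bool
P5adj i j = (suc (toℕ i) ≡ᵇ toℕ j) ∨ (suc (toℕ j) ≡ᵇ toℕ i)

-- complement of P5 (only consulted on distinct vertices)
coP5adj : Fin 5 → Fin 5 → Bool
coP5adj i j = not (P5adj i j)

C5adj : Fin 5 → Fin 5 → Bool
C5adj i j = P5adj i j ∨ ((toℕ i ≡ᵇ 0) ∨ (toℕ j ≡ᵇ 0)) ∧' ((toℕ i ≡ᵇ 4) ∨ (toℕ j ≡ᵇ 4))
  where
  _∧'_ : Bool → Bool → Bool
  true ∧' b = b
  false ∧' _ = false

InducedCopy : ∀ {k n} → (Fin k → Fin k → Bool) → Graph n → (Fin k → Fin n) → Set
InducedCopy Hadj G f =
  Injective _≡_ _≡_ f × (∀ i j → i ≢ j → adj G (f i) (f j) ≡ Hadj i j)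

PFree : ∀ {n} → Graph n → Set
PFree {n} G =
  ¬ (Σ (Fin 5 → Fin n) (InducedCopy P5adj G)) ×
  ¬ (Σ (Fin 5 → Fin n) (InducedCopy coP5adj G))

IsSplit : ∀ {n} → Graph n → Set
IsSplit {n} G = Σ (Fin n → Bool) λ K →
  (∀ u v → u ≢ v → K u ≡ true → K v ≡ true → adj G u v ≡ true) ×
  (∀ u v → u ≢ v → K u ≡ false → K v ≡ false → adj G u v ≡ false)

IsPentagon : ∀ {n} → Graph n → Set
IsPentagon G = Iso G (Fin 5) C5adj

SubstV : ∀ {n0 m} → Fin n0 → Graph m → Set
SubstV {n0} {m} x H = (Σ (Fin n0) λ v → v ≢ x) ⊎ Fin m

SubstAdj : ∀ {n0 m} (G0 : Graph n0) (x : Fin n0) (H : Graph m) →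
           SubstV x H → SubstV x H → Bool
SubstAdj G0 x H (inj₁ (u , _)) (inj₁ (v , _)) = adj G0 u v
SubstAdj G0 x H (inj₂ a)       (inj₂ b)       = adj H a b
SubstAdj G0 x H (inj₁ (u , _)) (inj₂ _)       = adj G0 u x
SubstAdj G0 x H (inj₂ _)       (inj₁ (v , _)) = adj G0 x v

BySubstitution : ∀ {n} → Graph n → Set
BySubstitution {n} G =
  Σ ℕ λ n0 → Σ ℕ λ m → Σ (Graph n0) λ G0 → Σ (Fin n0) λ x → Σ (Graph m) λ H →
    n0 < n × m < n × PFree G0 × PFree H × Iso G (SubstV x H) (SubstAdj G0 x H)

-- (d) split unification.
-- We identify the vertex set of G with A ∪ B ∪ C ∪ L ∪ T via a labelling.
-- Then G1 is G[A ∪ B ∪ L ∪ T] plus a vertex c* with neighbourhood B ∪ L,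
-- and G2 is G[B ∪ C ∪ L ∪ T] plus a vertex a* with neighbourhood B ∪ L.

data Lab : Set where
  lA lB lC lL lT : Lab

isBL : Lab → Bool
isBL lB = true
isBL lL = true
isBL _  = false

data AntiReach {n} (G : Graph n) (lab : Fin n → Lab) : Fin n → Fin n → Set where
  here : ∀ {v} → lab v ≡ lB → AntiReach G lab v v
  step : ∀ {u v w} → AntiReach G lab u v → lab w ≡ lB → v ≢ w →
         adj G v w ≡ false → AntiReach G lab u w

MixedOnAnticomp : ∀ {n} → Graph n → (Fin n → Lab) → Fin n → Fin n → Set
MixedOnAnticomp G lab c b = Σ _ λ b1 → Σ _ λ b2 →
  AntiReach G lab b b1 × AntiReach G lab b b2 ×
  adj G c b1 ≡ true × adj G c b2 ≡ false

-- the graph G1 (vertex c* = nothing)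
G1V : ∀ {n} → (Fin n → Lab) → Set
G1V {n} lab = Maybe (Σ (Fin n) λ v → lab v ≢ lC)

G1adj : ∀ {n} (G : Graph n) (lab : Fin n → Lab) → G1V lab → G1V lab → Bool
G1adj G lab (just (u , _)) (just (v , _)) = adj G u v
G1adj G lab nothing        (just (v , _)) = isBL (lab v)
G1adj G lab (just (u , _)) nothing        = isBL (lab u)
G1adj G lab nothing        nothing        = false

-- the graph G2 (vertex a* = nothing)
G2V : ∀ {n} → (Fin n → Lab) → Set
G2V {n} lab = Maybe (Σ (Fin n) λ v → lab v ≢ lA)

G2adj : ∀ {n} (G : Graph n) (lab : Fin n → Lab) → G2V lab → G2V lab → Bool
G2adj G lab (just (u , _)) (just (v , _)) = adj G u v
G2adj G lab nothing        (just (v , _)) = isBL (lab v)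
G2adj G lab (just (u , _)) nothing        = isBL (lab u)
G2adj G lab nothing        nothing        = false

SmallerFree : ℕ → (W : Set) → (W → W → Bool) → Set
SmallerFree n W F = Σ ℕ λ k → Σ (Graph k) λ H → k < n × PFree H × Iso H W F

BySplitUnification : ∀ {n} → Graph n → Set
BySplitUnification {n} G = Σ (Fin n → Lab) λ lab →
  let E = adj G in
  (Σ (Fin n) λ a → lab a ≡ lA) ×
  (Σ (Fin n) λ c → lab c ≡ lC) ×
  (∀ u v → u ≢ v → lab u ≡ lL → lab v ≡ lL → E u v ≡ true) ×
  (∀ u v → u ≢ v → lab u ≡ lT → lab v ≡ lT → E u v ≡ false) ×
  (∀ a b → lab a ≡ lA → lab b ≡ lB → E a b ≡ true) ×
  (∀ a t → lab a ≡ lA → lab t ≡ lT → E a t ≡ false) ×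
  (Σ (Fin n) λ a → lab a ≡ lA × (∀ l → lab l ≡ lL → E a l ≡ true)) ×
  (∀ t c → lab t ≡ lT → lab c ≡ lC → E t c ≡ false) ×
  (∀ l b → lab l ≡ lL → lab b ≡ lB → E l b ≡ true) ×
  (∀ l c → lab l ≡ lL → lab c ≡ lC → E l c ≡ true) ×
  (Σ (Fin n) λ c → lab c ≡ lC × (∀ b → lab b ≡ lB → E c b ≡ true)) ×
  (∀ c b → lab c ≡ lC → lab b ≡ lB → ¬ MixedOnAnticomp G lab c b) ×
  (∀ a c → lab a ≡ lA → lab c ≡ lC → E a c ≡ false) ×
  SmallerFree n (G1V lab) (G1adj G lab) ×
  SmallerFree n (G2V lab) (G2adj G lab)

{-# OPTIONS --safe #-}
module Submission where

-- The operations preserve {P5, co-P5}-freeness because P5 and its complement are prime (substitution), and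
-- because a copy of either in a split unification meets A or C so little that it survives in G1 or G2.
--
-- Conversely, a graph with a pentagon is the pentagon itself or has a homogeneous set. A C5-free graph which
-- is not split contains, itself or in its complement, two disjoint edges ab and cd with no edge between
-- them. Take an inclusion-minimal set X such that G − X has two components with an edge. Each vertex of X
-- then has a neighbour in every such component and is mixed on at most one of them, nonadjacent vertices of
-- X are mixed on the same component and have the same neighbours in these components, and every component contains
-- a vertex complete to X. If X is a clique, then for one such component A the vertices of X that are mixed on
-- A form L, the others form B, the remaining components with an edge form C, and the isolated vertices form
-- T. If X is not a clique, then the same construction succeeds in the complement.

open import Defs
open import Data.Nat using (ℕ)
open import Data.Sum using (_⊎_)
open import Function.Bundles using (_⇔_)

open import Data.Nat using (zero; suc; _<_)
open import Data.Nat.Induction using (<-wellFounded)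
open import Data.Bool using (Bool; true; false; not)
import Data.Bool as Bool
open import Data.Bool.Properties using (not-involutive; ¬-not)
open import Data.Empty using (⊥; ⊥-elim)
open import Data.Fin using (Fin; zero; suc; _≟_)
open import Data.Fin.Properties using (any?)
open import Data.Fin.Subset using (Subset; _∈_; _∉_; _⊆_; ∁; _-_; ∣_∣)
open import Data.Fin.Subset.Properties
  using (_∈?_; anySubset?; x∈p⇒x∉∁p; x∉p⇒x∈∁p; x∈∁p⇒x∉p; p─q⊆p; x∈p∧x≢y⇒x∈p-y; x∈p⇒∣p-x∣<∣p∣)
open import Data.List using (List; []; _∷_; filter; allFin; length)
import Data.List as List
open import Data.List.Properties using (filter-notAll; length-tabulate)
open import Data.List.Membership.Propositional using () renaming (_∈_ to _∈ₗ_)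
open import Data.List.Membership.Propositional.Properties using (∈-filter⁺; ∈-filter⁻; ∈-allFin; ∈-lookup)
import Data.List.Relation.Unary.All as All
open import Data.List.Relation.Unary.AllPairs using ([]; _∷_)
open import Data.List.Relation.Unary.Any using (index)
import Data.List.Relation.Unary.Any as Any
open import Data.List.Relation.Unary.Any.Properties using (lookup-index)
open import Data.List.Relation.Unary.Unique.Propositional using (Unique)
open import Data.List.Relation.Unary.Unique.Propositional.Properties using (filter⁺; allFin⁺)
open import Data.Maybe using (Maybe; just; nothing)
open import Data.Product using (Σ; ∃; _×_; _,_; proj₁; proj₂)
open import Data.Sum using (inj₁; inj₂; [_,_]′; swap)
open import Data.Unit using (⊤; tt)
open import Data.Vec using (Vec; []; _∷_; lookup; tabulate)
open import Data.Vec.Properties using (lookup∘tabulate; lookup⇒[]=; []=⇒lookup)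
open import Function using (_∘_; id)
open import Function.Bundles using (mk⇔; Inverse; mk↔ₛ′)
open import Induction.WellFounded using (Acc; acc)
open import Relation.Nullary using (¬_; Dec; yes; no; contradiction)
open import Relation.Nullary.Decidable
  using (does; dec-true; decidable-stable; map′; _×-dec_; _⊎-dec_; _→-dec_; ¬?; from-yes)
open import Relation.Binary.PropositionalEquality

-- Finite case checks by evaluation

Exhaustible : Set → Set₁
Exhaustible A = {P : A → Set} → (∀ a → Dec (P a)) → Dec (∀ a → P a)

∀Bool? : Exhaustible Bool
∀Bool? P? = map′ (λ { (t , f) → λ { true → t ; false → f } }) (λ h → h true , h false)
  (P? true ×-dec P? false)

∀Lab? : Exhaustible Lab
∀Lab? P? = map′
  (λ { (a , b , c , l , t) → λ { lA → a ; lB → b ; lC → c ; lL → l ; lT → t } })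
  (λ h → h lA , h lB , h lC , h lL , h lT)
  (P? lA ×-dec P? lB ×-dec P? lC ×-dec P? lL ×-dec P? lT)

∀Fin? : ∀ {k} → Exhaustible (Fin k)
∀Fin? {zero}  P? = yes λ ()
∀Fin? {suc k} P? = map′ (λ { (z , s) → λ { zero → z ; (suc i) → s i } })
  (λ h → h zero , λ i → h (suc i)) (P? zero ×-dec ∀Fin? (λ i → P? (suc i)))

∀Vec? : ∀ {A k} → Exhaustible A → Exhaustible (Vec A k)
∀Vec? {k = zero}  A? P? = map′ (λ p → λ { [] → p }) (λ h → h []) (P? [])
∀Vec? {k = suc k} A? P? = map′ (λ h → λ { (a ∷ v) → h a v }) (λ h a v → h (a ∷ v))
  (A? λ a → ∀Vec? A? λ v → P? (a ∷ v))

_≟L_ : (x y : Lab) → Dec (x ≡ y)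
lA ≟L lA = yes refl
lA ≟L lB = no λ ()
lA ≟L lC = no λ ()
lA ≟L lL = no λ ()
lA ≟L lT = no λ ()
lB ≟L lA = no λ ()
lB ≟L lB = yes refl
lB ≟L lC = no λ ()
lB ≟L lL = no λ ()
lB ≟L lT = no λ ()
lC ≟L lA = no λ ()
lC ≟L lB = no λ ()
lC ≟L lC = yes refl
lC ≟L lL = no λ ()
lC ≟L lT = no λ ()
lL ≟L lA = no λ ()
lL ≟L lB = no λ ()
lL ≟L lC = no λ ()
lL ≟L lL = yes refl
lL ≟L lT = no λ ()
lT ≟L lA = no λ ()
lT ≟L lB = no λ ()
lT ≟L lC = no λ ()
lT ≟L lL = no λ ()
lT ≟L lT = yes refl

true≢false : ∀ {b} → b ≡ true → b ≡ false → ⊥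
true≢false refl ()

-- Copies of P5 and of its complement

pat : Bool → Fin 5 → Fin 5 → Bool
pat true  = P5adj
pat false = coP5adj

Copy : ∀ {W : Set} → (W → W → Bool) → Bool → (Fin 5 → W) → Set
Copy F q f = ∀ i j → i ≢ j → F (f i) (f j) ≡ pat q i j

abstract
  pat-noTwins : ∀ q i j → i ≢ j → Σ (Fin 5) λ k → k ≢ i × k ≢ j × pat q i k ≢ pat q j k
  pat-noTwins = from-yes (∀Bool? λ q → ∀Fin? λ i → ∀Fin? λ j → ¬? (i ≟ j) →-dec
    any? λ k → ¬? (k ≟ i) ×-dec ¬? (k ≟ j) ×-dec ¬? (pat q i k Bool.≟ pat q j k))

pat-sym : ∀ q i j → pat q i j ≡ pat q j i
pat-sym = from-yes (∀Bool? λ q → ∀Fin? λ i → ∀Fin? λ j → pat q i j Bool.≟ pat q j i)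

-- If `i` and `j` had the same image, the vertex `k` that tells them apart in the pattern would see
-- that image in two ways.
copy-injective : ∀ {n} (G : Graph n) q f → Copy (adj G) q f → ∀ {i j} → f i ≡ f j → i ≡ j
copy-injective G q f h {i} {j} fi≡fj with i ≟ j
... | yes i≡j = i≡j
... | no i≢j with pat-noTwins q i j i≢j
... | k , k≢i , k≢j , ne = contradiction
  (trans (sym (h i k (k≢i ∘ sym))) (trans (cong (λ v → adj G v (f k)) fi≡fj) (h j k (k≢j ∘ sym)))) ne

noCopy : ∀ {n} (G : Graph n) → PFree G → ∀ q f → ¬ Copy (adj G) q f
noCopy G (noP , _) true  f h = noP (f , copy-injective G true f h , h)
noCopy G (_ , noQ) false f h = noQ (f , copy-injective G false f h , h)

mkPFree : ∀ {n} (G : Graph n) → (∀ q f → ¬ Copy (adj G) q f) → PFree G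
mkPFree G h = (λ { (f , _ , c) → h true f c }) , (λ { (f , _ , c) → h false f c })

iso-noCopy : ∀ {n} (G : Graph n) {W} F → Iso G W F → PFree G → ∀ q f → ¬ Copy F q f
iso-noCopy G F (φ , h) free q f c = noCopy G free q (Inverse.from φ ∘ f) λ i j i≢j →
  trans (h _ _) (trans (cong₂ F (Inverse.strictlyInverseˡ φ _) (Inverse.strictlyInverseˡ φ _)) (c i j i≢j))

noCopy-iso : ∀ {n} (G : Graph n) {W} F → Iso G W F → (∀ q f → ¬ Copy F q f) → PFree G
noCopy-iso G F (φ , h) free = mkPFree G λ q f c → free q (Inverse.to φ ∘ f) λ i j i≢j →
  trans (sym (h _ _)) (c i j i≢j)

compl-adj : ∀ {n} (G : Graph n) {u v} → u ≢ v → adj (compl G) u v ≡ not (adj G u v)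
compl-adj G {u} {v} u≢v with u ≟ v
... | yes p = contradiction p u≢v
... | no _  = refl

pat-not : ∀ q i j → not (pat q i j) ≡ pat (not q) i j
pat-not true  i j = refl
pat-not false i j = not-involutive _

-- A relation rather than the operation `compl`, because complementing twice need not return the
-- same record. Being symmetric, it lets a graph and its complement exchange roles.
Complementary : ∀ {n} → Graph n → Graph n → Set
Complementary G H = ∀ {u v} → u ≢ v → adj H u v ≡ not (adj G u v)

Complementary-sym : ∀ {n} {G H : Graph n} → Complementary G H → Complementary H G
Complementary-sym GH u≢v = trans (sym (not-involutive _)) (cong not (sym (GH u≢v)))

PFree-compl : ∀ {n} (G H : Graph n) → Complementary G H → PFree H → PFree G
PFree-compl G H GH free = mkPFree G λ q f c → noCopy H free (not q) f λ i j i≢j →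
  trans (GH (i≢j ∘ copy-injective G q f c)) (trans (cong not (c i j i≢j)) (pat-not q i j))

-- From decompositions to {P5, co-P5}-freeness

abstract
  -- The end edges of P5 are disjoint with no edge between them, so the complement of P5 contains an
  -- induced C4; a split graph contains neither.
  split-excludes : ∀ (q : Bool) (K : Vec Bool 5) →
    (∀ i j → i ≢ j → lookup K i ≡ true → lookup K j ≡ true → pat q i j ≡ true) →
    (∀ i j → i ≢ j → lookup K i ≡ false → lookup K j ≡ false → pat q i j ≡ false) → ⊥
  split-excludes q K h₁ h₂ = from-yes
    (∀Bool? λ q → ∀Vec? ∀Bool? λ K → ¬?
      ((∀Fin? λ i → ∀Fin? λ j → ¬? (i ≟ j) →-dec (lookup K i Bool.≟ true →-dec
         (lookup K j Bool.≟ true →-dec (pat q i j Bool.≟ true)))) ×-dec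
       (∀Fin? λ i → ∀Fin? λ j → ¬? (i ≟ j) →-dec (lookup K i Bool.≟ false →-dec
         (lookup K j Bool.≟ false →-dec (pat q i j Bool.≟ false))))))
    q K (h₁ , h₂)

split⇒PFree : ∀ {n} {G : Graph n} → IsSplit G → PFree G
split⇒PFree {G = G} (K , cl , st) = mkPFree G λ q f c →
  let inj = copy-injective G q f c
      K′ = tabulate (K ∘ f)
      K≡ = λ {b} i (e : lookup K′ i ≡ b) → trans (sym (lookup∘tabulate (K ∘ f) i)) e
  in split-excludes q K′
    (λ i j i≢j ki kj → trans (sym (c i j i≢j)) (cl _ _ (i≢j ∘ inj) (K≡ i ki) (K≡ j kj)))
    (λ i j i≢j ki kj → trans (sym (c i j i≢j)) (st _ _ (i≢j ∘ inj) (K≡ i ki) (K≡ j kj)))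

abstract
  -- C5 has five edges, whereas P5 has four and its complement six; a map that is not injective
  -- fails because the patterns have no twins.
  pentagon-excludes : ∀ q (f : Vec (Fin 5) 5) → ¬ (∀ i j → i ≢ j → C5adj (lookup f i) (lookup f j) ≡ pat q i j)
  pentagon-excludes = from-yes (∀Bool? λ q → ∀Vec? ∀Fin? λ f → ¬?
    (∀Fin? λ i → ∀Fin? λ j → ¬? (i ≟ j) →-dec (C5adj (lookup f i) (lookup f j) Bool.≟ pat q i j)))

pentagon⇒PFree : ∀ {n} {G : Graph n} → IsPentagon G → PFree G
pentagon⇒PFree {G = G} iso = noCopy-iso G C5adj iso λ q f c → pentagon-excludes q (tabulate f) λ i j i≢j →
  trans (cong₂ C5adj (lookup∘tabulate f i) (lookup∘tabulate f j)) (c i j i≢j)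

abstract
  -- Primeness of both patterns, with `S` as the characteristic vector of a homogeneous set.
  pat-prime : ∀ q (S : Vec Bool 5) →
    (∀ i j k → lookup S i ≡ true → lookup S j ≡ true → lookup S k ≡ false → pat q i k ≡ pat q j k) →
    (∀ i → lookup S i ≡ true) ⊎ (∀ i j → lookup S i ≡ true → lookup S j ≡ true → i ≡ j)
  pat-prime = from-yes (∀Bool? λ q → ∀Vec? ∀Bool? λ S →
    (∀Fin? λ i → ∀Fin? λ j → ∀Fin? λ k → lookup S i Bool.≟ true →-dec (lookup S j Bool.≟ true →-dec
      (lookup S k Bool.≟ false →-dec (pat q i k Bool.≟ pat q j k)))) →-dec
    ((∀Fin? λ i → lookup S i Bool.≟ true) ⊎-dec
     (∀Fin? λ i → ∀Fin? λ j → lookup S i Bool.≟ true →-dec (lookup S j Bool.≟ true →-dec (i ≟ j)))))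

isInj₂ : ∀ {A B : Set} → A ⊎ B → Bool
isInj₂ (inj₁ _) = false
isInj₂ (inj₂ _) = true

-- The vertices of a copy that lie in `H` form a homogeneous set of the pattern. By primeness the
-- copy lies in `H`, or has at most one vertex there, which `base` replaces by `x`.
subst⇒PFree : ∀ {n} {G : Graph n} → BySubstitution G → PFree G
subst⇒PFree {G = G} (n0 , m , G0 , x , H , _ , _ , free0 , freeH , iso) = noCopy-iso G (SubstAdj G0 x H) iso go
  where
  base : SubstV x H → Fin n0
  base (inj₁ (u , _)) = u
  base (inj₂ _)       = x

  hom : ∀ a b c → isInj₂ a ≡ true → isInj₂ b ≡ true → isInj₂ c ≡ false →
        SubstAdj G0 x H a c ≡ SubstAdj G0 x H b c
  hom (inj₂ _) (inj₂ _) (inj₁ _) _ _ _ = refl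

  base-adj : ∀ a b → isInj₂ a ≡ false ⊎ isInj₂ b ≡ false → adj G0 (base a) (base b) ≡ SubstAdj G0 x H a b
  base-adj (inj₁ _) (inj₁ _) _ = refl
  base-adj (inj₁ _) (inj₂ _) _ = refl
  base-adj (inj₂ _) (inj₁ _) _ = refl
  base-adj (inj₂ _) (inj₂ _) (inj₁ ())
  base-adj (inj₂ _) (inj₂ _) (inj₂ ())

  part : ∀ a → isInj₂ a ≡ true → Fin m
  part (inj₂ h) _ = h

  part-adj : ∀ a b (p : isInj₂ a ≡ true) (q : isInj₂ b ≡ true) →
             adj H (part a p) (part b q) ≡ SubstAdj G0 x H a b
  part-adj (inj₂ _) (inj₂ _) _ _ = refl

  go : ∀ q f → ¬ Copy (SubstAdj G0 x H) q f
  go q f c = [ all , one ]′ (pat-prime q S (λ i j k si sj sk → trans (sym (c i k (diff si sk)))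
      (trans (hom (f i) (f j) (f k) (S≡ i si) (S≡ j sj) (S≡ k sk)) (c j k (diff sj sk)))))
    where
    S = tabulate (isInj₂ ∘ f)
    S≡ : ∀ {b} i → lookup S i ≡ b → isInj₂ (f i) ≡ b
    S≡ i = trans (sym (lookup∘tabulate (isInj₂ ∘ f) i))
    diff : ∀ {i k} → lookup S i ≡ true → lookup S k ≡ false → i ≢ k
    diff si sk refl = true≢false si sk
    all : ¬ (∀ i → lookup S i ≡ true)
    all h = noCopy H freeH q (λ i → part (f i) (S≡ i (h i))) λ i j i≢j →
      trans (part-adj (f i) (f j) _ _) (c i j i≢j)
    one : ¬ (∀ i j → lookup S i ≡ true → lookup S j ≡ true → i ≡ j)
    one h = noCopy G0 free0 q (base ∘ f) λ i j i≢j → trans (base-adj (f i) (f j) (side i j i≢j)) (c i j i≢j)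
      where
      side : ∀ i j → i ≢ j → isInj₂ (f i) ≡ false ⊎ isInj₂ (f j) ≡ false
      side i j i≢j with isInj₂ (f i) in ei | isInj₂ (f j) in ej
      ... | false | _ = inj₁ refl
      ... | true  | false = inj₂ refl
      ... | true  | true  = contradiction
        (h i j (trans (lookup∘tabulate (isInj₂ ∘ f) i) ei) (trans (lookup∘tabulate (isInj₂ ∘ f) j) ej)) i≢j

forced : Lab → Lab → Maybe Bool
forced lL lL = just true
forced lT lT = just false
forced lA lB = just true
forced lA lT = just false
forced lT lC = just false
forced lL lB = just true
forced lL lC = just true
forced lA lC = just false
forced _  _  = nothing

Agrees : Maybe Bool → Bool → Set
Agrees nothing  e = ⊤
Agrees (just b) e = e ≡ b

agrees? : ∀ m e → Dec (Agrees m e)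
agrees? nothing  e = yes tt
agrees? (just b) e = e Bool.≟ b

-- For `lC` and `lB` the lone vertex has the neighbours of c* in the copy, for `lA` and `lL` those
-- of a*: its other adjacencies are forced.
AtMostOne : ∀ {k} → (Fin k → Fin k → Bool) → (Fin k → Lab) → Lab → Lab → Set
AtMostOne Q g l m = (∀ i j → g i ≡ l → g j ≡ l → i ≡ j) × (∀ i j → g i ≡ l → g j ≡ m → Q i j ≡ true)

atMostOne? : ∀ {k} (Q : Fin k → Fin k → Bool) g l m → Dec (AtMostOne Q g l m)
atMostOne? Q g l m =
  (∀Fin? λ i → ∀Fin? λ j → (g i ≟L l) →-dec ((g j ≟L l) →-dec (i ≟ j))) ×-dec
  (∀Fin? λ i → ∀Fin? λ j → (g i ≟L l) →-dec ((g j ≟L m) →-dec (Q i j Bool.≟ true)))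

-- A copy of P5 or of its complement in a split unification meets C (or A) in at most one vertex,
-- which can be replaced by c* (or a*).
abstract
  split-unification-copy : ∀ q (g : Vec Lab 5) →
    (∀ i j → i ≢ j → Agrees (forced (lookup g i) (lookup g j)) (pat q i j)) →
    (∀ c b b′ → lookup g c ≡ lC → lookup g b ≡ lB → lookup g b′ ≡ lB → b ≢ b′ →
       pat q b b′ ≡ false → pat q c b ≡ true → pat q c b′ ≡ true) →
    AtMostOne (pat q) (lookup g) lC lB ⊎ AtMostOne (pat q) (lookup g) lA lL
  split-unification-copy = from-yes (∀Bool? λ q → ∀Vec? ∀Lab? λ g →
    (∀Fin? λ i → ∀Fin? λ j → ¬? (i ≟ j) →-dec agrees? (forced (lookup g i) (lookup g j)) (pat q i j)) →-dec
    ((∀Fin? λ c → ∀Fin? λ b → ∀Fin? λ b′ → (lookup g c ≟L lC) →-dec ((lookup g b ≟L lB) →-dec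
      ((lookup g b′ ≟L lB) →-dec (¬? (b ≟ b′) →-dec ((pat q b b′ Bool.≟ false) →-dec
      ((pat q c b Bool.≟ true) →-dec (pat q c b′ Bool.≟ true))))))) →-dec
    (atMostOne? (pat q) (lookup g) lC lB ⊎-dec atMostOne? (pat q) (lookup g) lA lL)))

-- Both `G1V` and `G2V` have this form, with `lC` or `lA` contracted, so c* and a* are treated by
-- the same arguments.
Contracted : ∀ {n} → (Fin n → Lab) → Lab → Set
Contracted {n} lab l = Maybe (Σ (Fin n) λ v → lab v ≢ l)

record IsContraction {n} (G : Graph n) (lab : Fin n → Lab) (l : Lab)
                     (F : Contracted lab l → Contracted lab l → Bool) : Set where
  field
    old-old : ∀ u v → F (just u) (just v) ≡ adj G (proj₁ u) (proj₁ v)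
    new-old : ∀ v → F nothing (just v) ≡ isBL (lab (proj₁ v))
    old-new : ∀ v → F (just v) nothing ≡ isBL (lab (proj₁ v))
    new-new : F nothing nothing ≡ false
open IsContraction

G1-contraction : ∀ {n} (G : Graph n) lab → IsContraction G lab lC (G1adj G lab)
G1-contraction G lab = record
  { old-old = λ _ _ → refl ; new-old = λ _ → refl ; old-new = λ _ → refl ; new-new = refl }

G2-contraction : ∀ {n} (G : Graph n) lab → IsContraction G lab lA (G2adj G lab)
G2-contraction G lab = record
  { old-old = λ _ _ → refl ; new-old = λ _ → refl ; old-new = λ _ → refl ; new-new = refl }

-- Replacing the only vertex labelled `l`, if any, by the new vertex turns the copy into one in the
-- contracted graph.
contraction-noCopy : ∀ {n} {G : Graph n} {lab l F} → IsContraction G lab l F →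
  (∀ q f → ¬ Copy F q f) → ∀ q f → Copy (adj G) q f →
  (∀ i j → lab (f i) ≡ l → lab (f j) ≡ l → i ≡ j) →
  ¬ (∀ i j → lab (f i) ≡ l → lab (f j) ≢ l → pat q i j ≡ isBL (lab (f j)))
contraction-noCopy {n} {G} {lab} {l} {F} K free q f c uniq nbr = free q f′ copy
  where
  place : ∀ v → Dec (lab v ≡ l) → Contracted lab l
  place v (yes _) = nothing
  place v (no p)  = just (v , p)
  f′ : Fin 5 → Contracted lab l
  f′ i = place (f i) (lab (f i) ≟L l)
  copy : Copy F q f′
  copy i j i≢j with lab (f i) ≟L l | lab (f j) ≟L l
  ... | yes p | yes r = contradiction (uniq i j p r) i≢j
  ... | yes p | no r  = trans (new-old K _) (sym (nbr i j p r))
  ... | no p  | yes r = trans (old-new K (f i , p))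
    (trans (sym (nbr j i r p)) (trans (sym (c j i (i≢j ∘ sym))) (trans (adjSym G _ _) (c i j i≢j))))
  ... | no p  | no r  = trans (old-old K _ _) (c i j i≢j)

splitUnification⇒PFree : ∀ {n} {G : Graph n} → BySplitUnification G → PFree G
splitUnification⇒PFree {n} {G}
  (lab , _ , _ , LL , TT , AB , AT , _ , TC , LB , LC , _ , notMixed , AC ,
   (_ , H₁ , _ , free₁ , iso₁) , (_ , H₂ , _ , free₂ , iso₂)) = mkPFree G go
  where
  forced-adj : ∀ u v → u ≢ v → Agrees (forced (lab u) (lab v)) (adj G u v)
  forced-adj u v u≢v with lab u in eu | lab v in ev
  ... | lA | lA = tt
  ... | lA | lB = AB u v eu ev
  ... | lA | lC = AC u v eu ev
  ... | lA | lL = tt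
  ... | lA | lT = AT u v eu ev
  ... | lB | lA = tt
  ... | lB | lB = tt
  ... | lB | lC = tt
  ... | lB | lL = tt
  ... | lB | lT = tt
  ... | lC | lA = tt
  ... | lC | lB = tt
  ... | lC | lC = tt
  ... | lC | lL = tt
  ... | lC | lT = tt
  ... | lL | lA = tt
  ... | lL | lB = LB u v eu ev
  ... | lL | lC = LC u v eu ev
  ... | lL | lL = LL u v u≢v eu ev
  ... | lL | lT = tt
  ... | lT | lA = tt
  ... | lT | lB = tt
  ... | lT | lC = TC u v eu ev
  ... | lT | lL = tt
  ... | lT | lT = TT u v u≢v eu ev

  go : ∀ q f → ¬ Copy (adj G) q f
  go q f c = [ atC , atA ]′ (split-unification-copy q (tabulate (lab ∘ f))
      (λ i j i≢j → subst₂ (λ x y → Agrees (forced x y) (pat q i j)) (sym (g≡ i)) (sym (g≡ j))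
        (subst (Agrees _) (c i j i≢j) (forced-adj (f i) (f j) (i≢j ∘ inj))))
      λ k b b′ gk gb gb′ b≢b′ bb′ kb → unmixed (lab≡ k gk) (lab≡ b gb) (lab≡ b′ gb′) b≢b′ bb′ kb)
    where
    inj : ∀ {i j} → f i ≡ f j → i ≡ j
    inj = copy-injective G q f c
    g≡ : ∀ i → lookup (tabulate (lab ∘ f)) i ≡ lab (f i)
    g≡ = lookup∘tabulate (lab ∘ f)
    lab≡ : ∀ {l} i → lookup (tabulate (lab ∘ f)) i ≡ l → lab (f i) ≡ l
    lab≡ i e = trans (sym (g≡ i)) e
    differ : ∀ {i j l} → lab (f i) ≡ l → lab (f j) ≢ l → i ≢ j
    differ p r refl = r p
    adjacency : ∀ {i j b} → i ≢ j → adj G (f i) (f j) ≡ b → pat q i j ≡ b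
    adjacency i≢j e = trans (sym (c _ _ i≢j)) e

    unmixed : ∀ {k b b′} → lab (f k) ≡ lC → lab (f b) ≡ lB → lab (f b′) ≡ lB → b ≢ b′ →
              pat q b b′ ≡ false → pat q k b ≡ true → pat q k b′ ≡ true
    unmixed {k} {b} {b′} lk lb lb′ b≢b′ bb′ kb with pat q k b′ in kb′
    ... | true  = refl
    -- Two nonadjacent vertices of B lie in a common anticomponent, by a single `step`.
    ... | false = ⊥-elim (notMixed (f k) (f b) lk lb (f b , f b′ , here lb ,
        step (here lb) lb′ (b≢b′ ∘ inj) (trans (c b b′ b≢b′) bb′) ,
        trans (c k b (differ lk (B≢C lb))) kb , trans (c k b′ (differ lk (B≢C lb′))) kb′))
      where
      B≢C : ∀ {v} → lab v ≡ lB → lab v ≢ lC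
      B≢C e e′ with trans (sym e) e′
      ... | ()

    atC : ¬ AtMostOne (pat q) (lookup (tabulate (lab ∘ f))) lC lB
    atC (uniq , compl-B) = contraction-noCopy {G = G} (G1-contraction G lab) (iso-noCopy H₁ (G1adj G lab) iso₁ free₁) q f c
        (λ i j p r → uniq i j (trans (g≡ i) p) (trans (g≡ j) r)) nbr
      where
      nbr : ∀ i j → lab (f i) ≡ lC → lab (f j) ≢ lC → pat q i j ≡ isBL (lab (f j))
      nbr i j p r with differ p r | lab (f j) in e
      ... | d | lA = adjacency d (trans (adjSym G _ _) (AC _ _ e p))
      ... | _ | lB = compl-B i j (trans (g≡ i) p) (trans (g≡ j) e)
      ... | _ | lC = contradiction e r
      ... | d | lL = adjacency d (trans (adjSym G _ _) (LC _ _ e p))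
      ... | d | lT = adjacency d (trans (adjSym G _ _) (TC _ _ e p))

    atA : ¬ AtMostOne (pat q) (lookup (tabulate (lab ∘ f))) lA lL
    atA (uniq , compl-L) = contraction-noCopy {G = G} (G2-contraction G lab) (iso-noCopy H₂ (G2adj G lab) iso₂ free₂) q f c
        (λ i j p r → uniq i j (trans (g≡ i) p) (trans (g≡ j) r)) nbr
      where
      nbr : ∀ i j → lab (f i) ≡ lA → lab (f j) ≢ lA → pat q i j ≡ isBL (lab (f j))
      nbr i j p r with differ p r | lab (f j) in e
      ... | _ | lA = contradiction e r
      ... | d | lB = adjacency d (AB _ _ p e)
      ... | d | lC = adjacency d (AC _ _ p e)
      ... | _ | lL = compl-L i j (trans (g≡ i) p) (trans (g≡ j) e)
      ... | d | lT = adjacency d (AT _ _ p e)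

-- Induced subgraphs

lookup-injective : ∀ {A : Set} {xs : List A} → Unique xs → ∀ i j → List.lookup xs i ≡ List.lookup xs j → i ≡ j
lookup-injective (p ∷ u) zero    zero    e = refl
lookup-injective (p ∷ u) zero    (suc j) e = contradiction e (All.lookup p (∈-lookup j))
lookup-injective (p ∷ u) (suc i) zero    e = contradiction (sym e) (All.lookup p (∈-lookup i))
lookup-injective (p ∷ u) (suc i) (suc j) e = cong suc (lookup-injective u i j e)

record Enumeration {n} (P : Fin n → Set) : Set where
  field
    size      : ℕ
    elem      : Fin size → Fin n
    elem-inj  : ∀ i j → elem i ≡ elem j → i ≡ j
    sound     : ∀ i → P (elem i)
    index-of  : ∀ v → P v → Fin size
    elem-index : ∀ v p → elem (index-of v p) ≡ v
    proper    : ∀ z → ¬ P z → size < n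

enumerate : ∀ {n} {P : Fin n → Set} → (∀ v → Dec (P v)) → Enumeration P
enumerate {n} P? = record
  { size       = length xs
  ; elem       = List.lookup xs
  ; elem-inj   = lookup-injective (filter⁺ P? (allFin⁺ n))
  ; sound      = λ i → proj₂ (∈-filter⁻ P? {xs = allFin n} (∈-lookup i))
  ; index-of   = λ v p → index (∈-filter⁺ P? (∈-allFin v) p)
  ; elem-index = λ v p → sym (lookup-index (∈-filter⁺ P? (∈-allFin v) p))
  ; proper     = λ z ¬pz → subst (length xs <_) (length-tabulate id)
      (filter-notAll P? (allFin n) (Any.map (λ { refl → ¬pz }) (∈-allFin z)))
  }
  where xs = filter P? (allFin n)

induced : ∀ {k n} → Graph n → (Fin k → Fin n) → Graph k
induced G e = record
  { adj    = λ i j → adj G (e i) (e j)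
  ; adjSym = λ i j → adjSym G (e i) (e j)
  ; adjIrr = λ i → adjIrr G (e i)
  }

induced-PFree : ∀ {k n} (G : Graph n) (e : Fin k → Fin n) → PFree G → PFree (induced G e)
induced-PFree G e free = mkPFree (induced G e) λ q f → noCopy G free q (e ∘ f)

-- The graph is `G` restricted to the image of `g` and renumbered; the missed vertex `z` makes it
-- strictly smaller.
induced-smaller : ∀ {n} (G : Graph n) {W F} → PFree G → (g : W → Fin n) →
  (∀ a b → g a ≡ g b → a ≡ b) → (∀ a b → adj G (g a) (g b) ≡ F a b) →
  (∀ v → Dec (∃ λ w → g w ≡ v)) → (z : Fin n) → (∀ w → g w ≢ z) → SmallerFree n W F
induced-smaller G {W} {F} free g g-inj g-adj image? z z∉ =
  size , induced G elem , proper z (λ { (w , e) → z∉ w e }) , induced-PFree G elem free ,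
  mk↔ₛ′ to from (λ w → g-inj _ _ (trans (g-to (from w)) (elem-index (g w) (w , refl))))
    (λ i → elem-inj _ _ (trans (elem-index _ _) (g-to i))) ,
  λ i j → trans (cong₂ (adj G) (sym (g-to i)) (sym (g-to j))) (g-adj (to i) (to j))
  where
  open Enumeration (enumerate image?)
  to : Fin size → W
  to i = proj₁ (sound i)
  g-to : ∀ i → g (to i) ≡ elem i
  g-to i = proj₂ (sound i)
  from : W → Fin size
  from w = index-of (g w) (w , refl)

-- The vertex `c` itself plays the new vertex, so the contracted graph is an induced subgraph of
-- `G`. It omits `c′` and is therefore smaller.
contraction-smaller : ∀ {n} (G : Graph n) {lab l F} → IsContraction G lab l F → PFree G →
  ∀ c c′ → lab c ≡ l → lab c′ ≡ l → c ≢ c′ →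
  (∀ v → lab v ≢ l → adj G c v ≡ isBL (lab v)) → SmallerFree n (Contracted lab l) F
contraction-smaller {n} G {lab} {l} {F} K free c c′ lc lc′ c≢c′ nbr =
  induced-smaller G free g g-inj g-adj image? c′ c′∉
  where
  g : Contracted lab l → Fin n
  g nothing        = c
  g (just (v , _)) = v
  g-inj : ∀ a b → g a ≡ g b → a ≡ b
  g-inj (just _)       (just _)       refl = refl
  g-inj (just (v , p)) nothing        refl = contradiction lc p
  g-inj nothing        (just (v , p)) refl = contradiction lc p
  g-inj nothing        nothing        _    = refl
  g-adj : ∀ a b → adj G (g a) (g b) ≡ F a b
  g-adj (just u)       (just v)       = sym (old-old K u v)
  g-adj (just (u , p)) nothing        = trans (adjSym G u c) (trans (nbr u p) (sym (old-new K (u , p))))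
  g-adj nothing        (just (v , p)) = trans (nbr v p) (sym (new-old K (v , p)))
  g-adj nothing        nothing        = trans (adjIrr G c) (sym (new-new K))
  image? : ∀ v → Dec (∃ λ w → g w ≡ v)
  image? v with lab v ≟L l | c ≟ v
  ... | no p  | _      = yes (just (v , p) , refl)
  ... | yes _ | yes e  = yes (nothing , e)
  ... | yes p | no c≢v = no λ { (nothing , e) → c≢v e ; (just (u , r) , refl) → r p }
  c′∉ : ∀ w → g w ≢ c′
  c′∉ nothing        e    = c≢c′ e
  c′∉ (just (v , p)) refl = p lc′

-- Homogeneous sets and substitution

Homogeneous : ∀ {n} → Graph n → (Fin n → Set) → Set
Homogeneous G S = ∀ {u v z} → S u → S v → ¬ S z → adj G z u ≡ adj G z v

-- `S` shrinks to its member `s`, which becomes the vertex `x`, and G[S] is substituted for it. The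
-- outer graph loses `s′` and the inner one `z`.
homogeneous⇒substitution : ∀ {n} (G : Graph n) {S : Fin n → Set} → (∀ v → Dec (S v)) → PFree G →
  Homogeneous G S → ∀ {s s′ z} → S s → S s′ → s ≢ s′ → ¬ S z → BySubstitution G
homogeneous⇒substitution {n} G {S} S? free hom {s} {s′} {z} Ss Ss′ s≢s′ ¬Sz =
  O.size , I.size , induced G O.elem , x , induced G I.elem ,
  O.proper s′ [ contradiction Ss′ , (λ e → s≢s′ (sym e)) ]′ , I.proper z ¬Sz ,
  induced-PFree G O.elem free , induced-PFree G I.elem free ,
  mk↔ₛ′ (λ u → to u (S? u)) from to-from (λ u → from-to u (S? u)) , λ u v → to-adj u v (S? u) (S? v)
  where
  Out : Fin n → Set
  Out v = ¬ S v ⊎ v ≡ s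
  module O = Enumeration (enumerate {P = Out} (λ v → ¬? (S? v) ⊎-dec (v ≟ s)))
  module I = Enumeration (enumerate S?)
  x : Fin O.size
  x = O.index-of s (inj₂ refl)
  x-elem : O.elem x ≡ s
  x-elem = O.elem-index s (inj₂ refl)
  V : Set
  V = SubstV x (induced G I.elem)

  to : ∀ u → Dec (S u) → V
  to u (yes p) = inj₂ (I.index-of u p)
  to u (no ¬p) = inj₁ (O.index-of u (inj₁ ¬p) ,
    λ e → ¬p (subst S (trans (sym x-elem) (trans (cong O.elem (sym e)) (O.elem-index u _))) Ss))

  from : V → Fin n
  from (inj₁ (i , _)) = O.elem i
  from (inj₂ j)       = I.elem j

  from-to : ∀ u d → from (to u d) ≡ u
  from-to u (yes p) = I.elem-index u p
  from-to u (no ¬p) = O.elem-index u (inj₁ ¬p)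

  outside : ∀ i → i ≢ x → ¬ S (O.elem i)
  outside i i≢x with O.sound i
  ... | inj₁ ¬p = ¬p
  ... | inj₂ e  = contradiction (O.elem-inj i x (trans e (sym x-elem))) i≢x

  from-inj : ∀ a b → from a ≡ from b → a ≡ b
  from-inj (inj₁ (i , p)) (inj₁ (j , q)) e with O.elem-inj i j e
  ... | refl = refl
  from-inj (inj₁ (i , p)) (inj₂ j) e = contradiction (subst S (sym e) (I.sound j)) (outside i p)
  from-inj (inj₂ i) (inj₁ (j , q)) e = contradiction (subst S e (I.sound i)) (outside j q)
  from-inj (inj₂ i) (inj₂ j) e = cong inj₂ (I.elem-inj i j e)

  to-from : ∀ a → to (from a) (S? (from a)) ≡ a
  to-from a = from-inj _ _ (from-to (from a) (S? (from a)))

  to-adj : ∀ u v (d : Dec (S u)) (d′ : Dec (S v)) →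
           adj G u v ≡ SubstAdj (induced G O.elem) x (induced G I.elem) (to u d) (to v d′)
  to-adj u v (yes p) (yes q) = sym (cong₂ (adj G) (I.elem-index u p) (I.elem-index v q))
  to-adj u v (yes p) (no ¬q) = trans (adjSym G u v) (trans (hom p Ss ¬q) (trans (adjSym G v s)
    (sym (cong₂ (adj G) x-elem (O.elem-index v (inj₁ ¬q))))))
  to-adj u v (no ¬p) (yes q) = trans (hom q Ss ¬p) (sym (cong₂ (adj G) (O.elem-index u (inj₁ ¬p)) x-elem))
  to-adj u v (no ¬p) (no ¬q) = sym (cong₂ (adj G) (O.elem-index u (inj₁ ¬p)) (O.elem-index v (inj₁ ¬q)))

-- Induced pentagons

∃Vec? : ∀ {n k} {P : Vec (Fin n) k → Set} → (∀ v → Dec (P v)) → Dec (∃ P)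
∃Vec? {k = zero}  P? = map′ (λ p → [] , p) (λ { ([] , p) → p }) (P? [])
∃Vec? {k = suc k} P? = map′ (λ { (a , v , p) → a ∷ v , p }) (λ { (a ∷ v , p) → a , v , p })
  (any? λ a → ∃Vec? λ v → P? (a ∷ v))

IsC5 : ∀ {n} → Graph n → (Fin 5 → Fin n) → Set
IsC5 G c = ∀ i j → adj G (c i) (c j) ≡ C5adj i j

-- The entry at `i` is left open: a vertex in the class of `i` may or may not be adjacent to that
-- vertex of the pentagon.
LikeVertex : Fin 5 → (Fin 5 → Bool) → Set
LikeVertex i r = ∀ j → j ≢ i → r j ≡ C5adj i j

likeVertex? : ∀ i r → Dec (LikeVertex i r)
likeVertex? i r = ∀Fin? λ j → ¬? (j ≟ i) →-dec (r j Bool.≟ C5adj i j)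

Constant : Bool → (Fin 5 → Bool) → Set
Constant b r = ∀ j → r j ≡ b

Admissible : (Fin 5 → Bool) → Set
Admissible r = (Constant true r ⊎ Constant false r) ⊎ (∃ λ i → LikeVertex i r)

admissible? : ∀ r → Dec (Admissible r)
admissible? r = ((∀Fin? λ j → r j Bool.≟ true) ⊎-dec (∀Fin? λ j → r j Bool.≟ false)) ⊎-dec any? λ i → likeVertex? i r

-- Vertex `zero` of the pattern is the vertex with row `r`, and `m` places the other four on the
-- pentagon.
RowCopy : Bool → (Fin 5 → Bool) → Vec (Fin 5) 4 → Set
RowCopy q r m = (∀ a → r (lookup m a) ≡ pat q zero (suc a)) ×
                (∀ a b → a ≢ b → C5adj (lookup m a) (lookup m b) ≡ pat q (suc a) (suc b))

abstract
  admissible-or-copy : ∀ (r : Vec Bool 5) → Admissible (lookup r) ⊎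
    (∃ (RowCopy true (lookup r)) ⊎ ∃ (RowCopy false (lookup r)))
  admissible-or-copy = from-yes (∀Vec? ∀Bool? λ r → admissible? (lookup r) ⊎-dec
    (∃Vec? (copy? true (lookup r)) ⊎-dec ∃Vec? (copy? false (lookup r))))
    where
    copy? : ∀ q r m → Dec (RowCopy q r m)
    copy? q r m = (∀Fin? λ a → r (lookup m a) Bool.≟ pat q zero (suc a)) ×-dec
      (∀Fin? λ a → ∀Fin? λ b → ¬? (a ≟ b) →-dec (C5adj (lookup m a) (lookup m b) Bool.≟ pat q (suc a) (suc b)))

  -- Admissible rows mark no vertex, all five, two nonadjacent ones or three consecutive ones. Two
  -- of them that differ in a single entry mark the neighbours of one vertex, without and with that
  -- vertex, so both are like it.
  admissible-rigid : ∀ i (r r′ : Vec Bool 5) → (∀ j → j ≢ i → lookup r j ≡ lookup r′ j) →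
    Admissible (lookup r) → Admissible (lookup r′) → ¬ LikeVertex i (lookup r) → lookup r′ i ≡ lookup r i
  admissible-rigid = from-yes (∀Fin? λ i → ∀Vec? ∀Bool? λ r → ∀Vec? ∀Bool? λ r′ →
    (∀Fin? λ j → ¬? (j ≟ i) →-dec (lookup r j Bool.≟ lookup r′ j)) →-dec
    (admissible? (lookup r) →-dec (admissible? (lookup r′) →-dec (¬? (likeVertex? i (lookup r)) →-dec
    (lookup r′ i Bool.≟ lookup r i)))))

  C5-noTwins : ∀ i j → j ≢ i → ¬ LikeVertex i (C5adj j)
  C5-noTwins = from-yes (∀Fin? λ i → ∀Fin? λ j → ¬? (j ≟ i) →-dec ¬? (likeVertex? i (C5adj j)))

  another : ∀ (i : Fin 5) → ∃ λ j → j ≢ i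
  another = from-yes (∀Fin? {5} λ i → any? λ j → ¬? (j ≟ i))

LikeVertex-cong : ∀ {i r r′} → (∀ j → r j ≡ r′ j) → LikeVertex i r → LikeVertex i r′
LikeVertex-cong e h j j≢i = trans (sym (e j)) (h j j≢i)

Admissible-cong : ∀ {r r′} → (∀ j → r j ≡ r′ j) → Admissible r → Admissible r′
Admissible-cong e (inj₁ (inj₁ h)) = inj₁ (inj₁ λ j → trans (sym (e j)) (h j))
Admissible-cong e (inj₁ (inj₂ h)) = inj₁ (inj₂ λ j → trans (sym (e j)) (h j))
Admissible-cong e (inj₂ (i , h))  = inj₂ (i , LikeVertex-cong e h)

row-admissible : ∀ {n} (G : Graph n) → PFree G → ∀ c → IsC5 G c → ∀ v → Admissible (adj G v ∘ c)
row-admissible {n} G free c hc v with admissible-or-copy (tabulate (adj G v ∘ c))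
... | inj₁ adm = Admissible-cong (lookup∘tabulate (adj G v ∘ c)) adm
... | inj₂ cp  = ⊥-elim ([ no-copy true , no-copy false ]′ cp)
  where
  no-copy : ∀ q → ¬ ∃ (RowCopy q (lookup (tabulate (adj G v ∘ c))))
  no-copy q (m , hv , hm) = noCopy G free q f copy
    where
    f : Fin 5 → Fin n
    f zero    = v
    f (suc a) = c (lookup m a)
    hv′ : ∀ a → adj G v (c (lookup m a)) ≡ pat q zero (suc a)
    hv′ a = trans (sym (lookup∘tabulate (adj G v ∘ c) (lookup m a))) (hv a)
    copy : Copy (adj G) q f
    copy zero    zero    ne = contradiction refl ne
    copy zero    (suc b) _  = hv′ b
    copy (suc a) zero    _  = trans (adjSym G _ _) (trans (hv′ a) (pat-sym q zero (suc a)))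
    copy (suc a) (suc b) ne = trans (hc _ _) (hm a b (ne ∘ cong suc))

-- Fouquet's theorem. A vertex sees an induced pentagon c either like one of its vertices c i, or is
-- complete or anticomplete to it. The class of c i stays unchanged when c i is exchanged for another
-- member v of it, whence all other vertices see v like c i.
module Pentagon {n} (G : Graph n) (free : PFree G) (c : Fin 5 → Fin n) (hc : IsC5 G c) where

  Class : Fin 5 → Fin n → Set
  Class i v = LikeVertex i (adj G v ∘ c)

  class? : ∀ i v → Dec (Class i v)
  class? i v = likeVertex? i (adj G v ∘ c)

  class-self : ∀ i → Class i (c i)
  class-self i j _ = hc i j

  class-other : ∀ i j → j ≢ i → ¬ Class i (c j)
  class-other i j j≢i h = C5-noTwins i j j≢i (LikeVertex-cong (hc j) h)

  exchange : ∀ i v → (j : Fin 5) → Dec (j ≡ i) → Fin n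
  exchange i v j (yes _) = v
  exchange i v j (no _)  = c j

  exchange-C5 : ∀ i v → Class i v → IsC5 G (λ j → exchange i v j (j ≟ i))
  exchange-C5 i v cv j k with j ≟ i | k ≟ i
  ... | yes refl | yes refl = trans (adjIrr G v) (trans (sym (adjIrr G (c i))) (hc i i))
  ... | yes refl | no k≢i   = cv k k≢i
  ... | no j≢i   | yes refl = trans (adjSym G _ _) (trans (cv j j≢i) (trans (sym (hc i j)) (trans (adjSym G _ _) (hc j i))))
  ... | no _     | no _     = hc j k

  -- `w` has admissible rows on `c` and on the pentagon with `v` in place of `c i`. They agree away
  -- from `i`, hence also at `i` by `admissible-rigid`.
  class-seen : ∀ i {v w} → Class i v → ¬ Class i w → adj G w v ≡ adj G w (c i)
  class-seen i {v} {w} cv ¬cw = trans (sym (trans (row′≡ i) at-i)) (trans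
      (admissible-rigid i (tabulate (adj G w ∘ c)) (tabulate (adj G w ∘ c′)) agree
        (Admissible-cong (sym ∘ row≡) (row-admissible G free c hc w))
        (Admissible-cong (sym ∘ row′≡) (row-admissible G free c′ (exchange-C5 i v cv) w))
        (¬cw ∘ LikeVertex-cong row≡))
      (row≡ i))
    where
    c′ : Fin 5 → Fin n
    c′ j = exchange i v j (j ≟ i)
    row≡ : ∀ j → lookup (tabulate (adj G w ∘ c)) j ≡ adj G w (c j)
    row≡ = lookup∘tabulate (adj G w ∘ c)
    row′≡ : ∀ j → lookup (tabulate (adj G w ∘ c′)) j ≡ adj G w (c′ j)
    row′≡ = lookup∘tabulate (adj G w ∘ c′)
    at-i : adj G w (c′ i) ≡ adj G w v
    at-i with i ≟ i
    ... | yes _ = refl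
    ... | no ne = contradiction refl ne
    off-i : ∀ j → j ≢ i → adj G w (c j) ≡ adj G w (c′ j)
    off-i j j≢i with j ≟ i
    ... | yes e = contradiction e j≢i
    ... | no _  = refl
    agree : ∀ j → j ≢ i → lookup (tabulate (adj G w ∘ c)) j ≡ lookup (tabulate (adj G w ∘ c′)) j
    agree j j≢i = trans (row≡ j) (trans (off-i j j≢i) (sym (row′≡ j)))

  InClass : Fin n → Set
  InClass v = ∃ λ i → Class i v

  class-homogeneous : ∀ i → Homogeneous G (Class i)
  class-homogeneous i cu cv ¬cz = trans (class-seen i cu ¬cz) (sym (class-seen i cv ¬cz))

  -- A vertex in no class is complete or anticomplete to the pentagon, and sees each class as it
  -- sees the pentagon vertex of that class.
  union-homogeneous : Homogeneous G InClass
  union-homogeneous {u} {v} {z} (i , cu) (j , cv) ¬cz = trans (class-seen i cu (λ h → ¬cz (i , h)))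
      (trans (constant (row-admissible G free c hc z)) (sym (class-seen j cv (λ h → ¬cz (j , h)))))
    where
    constant : Admissible (adj G z ∘ c) → adj G z (c i) ≡ adj G z (c j)
    constant (inj₁ (inj₁ h)) = trans (h i) (sym (h j))
    constant (inj₁ (inj₂ h)) = trans (h i) (sym (h j))
    constant (inj₂ h)        = contradiction h ¬cz

  fouquet : IsPentagon G ⊎ BySubstitution G
  fouquet with any? (λ i → any? (λ v → class? i v ×-dec ¬? (c i ≟ v)))
  ... | yes (i , v , cv , ne) = inj₂ (homogeneous⇒substitution G (class? i) free (class-homogeneous i)
          (class-self i) cv ne (class-other i _ (proj₂ (another i))))
  ... | no singletons with any? (λ z → ¬? (any? (λ i → class? i z)))
  ... | yes (z , ¬cz) = inj₂ (homogeneous⇒substitution G (λ v → any? λ i → class? i v) free union-homogeneous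
          (zero , class-self zero) (suc zero , class-self (suc zero)) distinct ¬cz)
    where
    distinct : c zero ≢ c (suc zero)
    distinct e = class-other zero (suc zero) (λ ()) (subst (Class zero) e (class-self zero))
  -- Every vertex belongs to a class and every class has one member, so `c` is an isomorphism from
  -- C5.
  ... | no all = inj₁ (mk↔ₛ′ to c (λ i → to-c i (to (c i)) (proj₂ (classOf (c i)))) c-to ,
          λ u v → trans (sym (cong₂ (adj G) (c-to u) (c-to v))) (hc (to u) (to v)))
    where
    classOf : ∀ v → InClass v
    classOf v with any? (λ i → class? i v)
    ... | yes p = p
    ... | no ¬p = contradiction (v , ¬p) all
    to : Fin n → Fin 5
    to v = proj₁ (classOf v)
    to-c : ∀ i j → Class j (c i) → j ≡ i
    to-c i j h with i ≟ j
    ... | yes e = sym e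
    ... | no ne = contradiction h (class-other j i ne)
    c-to : ∀ v → c (to v) ≡ v
    c-to v with c (to v) ≟ v
    ... | yes e = e
    ... | no ne = contradiction (to v , v , proj₂ (classOf v) , ne) singletons

-- Forbidden subgraphs on named vertices

pattern #0 = zero
pattern #1 = suc zero
pattern #2 = suc (suc zero)
pattern #3 = suc (suc (suc zero))
pattern #4 = suc (suc (suc (suc zero)))

fill : ∀ {n} (G : Graph n) (Q : Fin 5 → Fin 5 → Bool) → (∀ i j → Q i j ≡ Q j i) → ∀ a b c d e →
  adj G a b ≡ Q #0 #1 → adj G a c ≡ Q #0 #2 → adj G a d ≡ Q #0 #3 → adj G a e ≡ Q #0 #4 →
  adj G b c ≡ Q #1 #2 → adj G b d ≡ Q #1 #3 → adj G b e ≡ Q #1 #4 →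
  adj G c d ≡ Q #2 #3 → adj G c e ≡ Q #2 #4 →
  adj G d e ≡ Q #3 #4 →
  ∀ i j → i ≢ j → adj G (lookup (a ∷ b ∷ c ∷ d ∷ e ∷ []) i) (lookup (a ∷ b ∷ c ∷ d ∷ e ∷ []) j) ≡ Q i j
fill G Q Q-sym a b c d e ab ac ad ae bc bd be cd ce de = go
  where
  flip : ∀ {u v} i j → adj G u v ≡ Q i j → adj G v u ≡ Q j i
  flip i j h = trans (adjSym G _ _) (trans h (Q-sym i j))
  go : ∀ i j → i ≢ j → adj G (lookup (a ∷ b ∷ c ∷ d ∷ e ∷ []) i) (lookup (a ∷ b ∷ c ∷ d ∷ e ∷ []) j) ≡ Q i j
  go #0 #0 ne = contradiction refl ne
  go #0 #1 _  = ab
  go #0 #2 _  = ac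
  go #0 #3 _  = ad
  go #0 #4 _  = ae
  go #1 #0 _  = flip #0 #1 ab
  go #1 #1 ne = contradiction refl ne
  go #1 #2 _  = bc
  go #1 #3 _  = bd
  go #1 #4 _  = be
  go #2 #0 _  = flip #0 #2 ac
  go #2 #1 _  = flip #1 #2 bc
  go #2 #2 ne = contradiction refl ne
  go #2 #3 _  = cd
  go #2 #4 _  = ce
  go #3 #0 _  = flip #0 #3 ad
  go #3 #1 _  = flip #1 #3 bd
  go #3 #2 _  = flip #2 #3 cd
  go #3 #3 ne = contradiction refl ne
  go #3 #4 _  = de
  go #4 #0 _  = flip #0 #4 ae
  go #4 #1 _  = flip #1 #4 be
  go #4 #2 _  = flip #2 #4 ce
  go #4 #3 _  = flip #3 #4 de
  go #4 #4 ne = contradiction refl ne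

C5adj-sym : ∀ i j → C5adj i j ≡ C5adj j i
C5adj-sym = from-yes (∀Fin? λ i → ∀Fin? λ j → C5adj i j Bool.≟ C5adj j i)

C5adj-irr : ∀ i → C5adj i i ≡ false
C5adj-irr = from-yes (∀Fin? λ i → C5adj i i Bool.≟ false)

module Notation {n} (G : Graph n) where
  infix 4 _~_ _≁_
  _~_ _≁_ : Fin n → Fin n → Set
  u ~ v = adj G u v ≡ true
  u ≁ v = adj G u v ≡ false

  ~sym : ∀ {u v} → u ~ v → v ~ u
  ~sym h = trans (adjSym G _ _) h

  ≁sym : ∀ {u v} → u ≁ v → v ≁ u
  ≁sym h = trans (adjSym G _ _) h

  ~⇒≢ : ∀ {u v} → u ~ v → u ≢ v
  ~⇒≢ h refl = true≢false h (adjIrr G _)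

  ¬~⇒≁ : ∀ {u v} → ¬ u ~ v → u ≁ v
  ¬~⇒≁ = ¬-not

  ¬≁⇒~ : ∀ {u v} → ¬ u ≁ v → u ~ v
  ¬≁⇒~ = ¬-not

NoC5 : ∀ {n} → Graph n → Set
NoC5 G = ∀ c → ¬ IsC5 G c

module Forbidden {n} (G : Graph n) where
  open Notation G

  -- The hypotheses run through the ten pairs in lexicographic order, the path being `a b c d e`.
  -- The order is kept below, where `a b c d e` is a path of the complement and then a pentagon.
  noP5 : PFree G → ∀ {a b c d e} → a ~ b → a ≁ c → a ≁ d → a ≁ e →
         b ~ c → b ≁ d → b ≁ e → c ~ d → c ≁ e → d ~ e → ⊥
  noP5 free h₁ h₂ h₃ h₄ h₅ h₆ h₇ h₈ h₉ h₁₀ =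
    noCopy G free true _ (fill G P5adj (pat-sym true) _ _ _ _ _ h₁ h₂ h₃ h₄ h₅ h₆ h₇ h₈ h₉ h₁₀)

  noCoP5 : PFree G → ∀ {a b c d e} → a ≁ b → a ~ c → a ~ d → a ~ e →
            b ≁ c → b ~ d → b ~ e → c ≁ d → c ~ e → d ≁ e → ⊥
  noCoP5 free h₁ h₂ h₃ h₄ h₅ h₆ h₇ h₈ h₉ h₁₀ =
    noCopy G free false _ (fill G coP5adj (pat-sym false) _ _ _ _ _ h₁ h₂ h₃ h₄ h₅ h₆ h₇ h₈ h₉ h₁₀)

  noPentagon : NoC5 G → ∀ {a b c d e} → a ~ b → a ≁ c → a ≁ d → a ~ e →
         b ~ c → b ≁ d → b ≁ e → c ~ d → c ≁ e → d ~ e → ⊥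
  noPentagon noC5 {a} {b} {c} {d} {e} h₁ h₂ h₃ h₄ h₅ h₆ h₇ h₈ h₉ h₁₀ = noC5 f all
    where
    f : Fin 5 → Fin n
    f = lookup (a ∷ b ∷ c ∷ d ∷ e ∷ [])
    all : IsC5 G f
    all i j with i ≟ j
    ... | no ne    = fill G C5adj C5adj-sym a b c d e h₁ h₂ h₃ h₄ h₅ h₆ h₇ h₈ h₉ h₁₀ i j ne
    ... | yes refl = trans (adjIrr G (f i)) (sym (C5adj-irr i))

-- A vertex is not adjacent to itself, whence the distinctness hypotheses on opposite vertices.
NoC4 : ∀ {n} → Graph n → Set
NoC4 G = ∀ {a b c d} → a ~ b → b ~ c → c ~ d → d ~ a → a ≁ c → b ≁ d → a ≢ c → b ≢ d → ⊥
  where open Notation G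

No2K2 : ∀ {n} → Graph n → Set
No2K2 G = ∀ {a b c d} → a ~ b → c ~ d → a ≁ c → a ≁ d → b ≁ c → b ≁ d → ⊥
  where open Notation G

-- Split graphs

Splits : ∀ {n} → Graph n → (Fin n → Bool) → Set
Splits G K = (∀ u v → u ≢ v → K u ≡ true → K v ≡ true → adj G u v ≡ true) ×
             (∀ u v → u ≢ v → K u ≡ false → K v ≡ false → adj G u v ≡ false)

_[_↦_] : ∀ {n} → (Fin n → Bool) → Fin n → Bool → Fin n → Bool
(K [ s ↦ b ]) v with v ≟ s
... | yes _ = b
... | no _  = K v

updated : ∀ {n} (K : Fin n → Bool) s b {x} v → (K [ s ↦ b ]) v ≡ x → (v ≡ s × b ≡ x) ⊎ (v ≢ s × K v ≡ x)
updated K s b v e with v ≟ s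
... | yes p = inj₁ (p , e)
... | no p  = inj₂ (p , e)

updated-at : ∀ {n} (K : Fin n → Bool) s b → (K [ s ↦ b ]) s ≡ b
updated-at K s b with s ≟ s
... | yes _ = refl
... | no p  = contradiction refl p

Maximal : ∀ {n} → Graph n → (Fin n → Bool) → Set
Maximal G K = ∀ s → K s ≡ false → ∃ λ k → K k ≡ true × adj G s k ≡ false

-- One move suffices: once a vertex `s` of the stable set has joined the clique, every remaining
-- stable vertex misses `s`.
enlarge : ∀ {n} (G : Graph n) K → Splits G K → Σ (Fin n → Bool) λ K′ → Splits G K′ × Maximal G K′
enlarge {n} G K (cl , st)
  with any? (λ s → (K s Bool.≟ false) ×-dec ∀Fin? (λ k → (K k Bool.≟ true) →-dec (adj G s k Bool.≟ true)))
... | no none = K , (cl , st) , maximal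
  where
  maximal : Maximal G K
  maximal s ks with any? (λ k → (K k Bool.≟ true) ×-dec (adj G s k Bool.≟ false))
  ... | yes p = p
  ... | no ¬p = contradiction (s , ks , λ k kk → ¬-not λ e → ¬p (k , kk , e)) none
... | yes (s , ks , all) = K′ , (cl′ , st′) , λ s′ ks′ → s , updated-at K s true , toS s′ (updated K s true s′ ks′)
  where
  K′ : Fin n → Bool
  K′ = K [ s ↦ true ]
  toS : ∀ s′ → (s′ ≡ s × true ≡ false) ⊎ (s′ ≢ s × K s′ ≡ false) → adj G s′ s ≡ false
  toS s′ (inj₂ (ne , k)) = st s′ s ne k ks
  cl′ : ∀ u v → u ≢ v → K′ u ≡ true → K′ v ≡ true → adj G u v ≡ true
  cl′ u v u≢v ku kv with updated K s true u ku | updated K s true v kv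
  ... | inj₁ (refl , _) | inj₁ (refl , _) = contradiction refl u≢v
  ... | inj₁ (refl , _) | inj₂ (_ , kv′)  = all v kv′
  ... | inj₂ (_ , ku′)  | inj₁ (refl , _) = trans (adjSym G u v) (all u ku′)
  ... | inj₂ (_ , ku′)  | inj₂ (_ , kv′)  = cl u v u≢v ku′ kv′
  st′ : ∀ u v → u ≢ v → K′ u ≡ false → K′ v ≡ false → adj G u v ≡ false
  st′ u v u≢v ku kv with updated K s true u ku | updated K s true v kv
  ... | inj₂ (_ , ku′)  | inj₂ (_ , kv′)  = st u v u≢v ku′ kv′

-- Földes and Hammer: a vertex v is added to a partition whose clique K is maximal. If this fails, one
-- vertex of K is exchanged for v or for a neighbour of v.
module AddVertex {n} (G : Graph (suc n)) (no2K2 : No2K2 G) (noC4 : NoC4 G) (noC5 : NoC5 G)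
  (K : Fin n → Bool) (sp : Splits (induced G suc) K) (mx : Maximal (induced G suc) K) where
  open Notation G
  open Forbidden G

  v : Fin (suc n)
  v = zero

  cl : ∀ {u w} → u ≢ w → K u ≡ true → K w ≡ true → suc u ~ suc w
  cl = proj₁ sp _ _

  st : ∀ {u w} → u ≢ w → K u ≡ false → K w ≡ false → suc u ≁ suc w
  st = proj₂ sp _ _

  suc-≢ : {u w : Fin n} → u ≢ w → _≢_ {A = Fin (suc n)} (suc u) (suc w)
  suc-≢ ne refl = ne refl

  sides : ∀ {u w} → K u ≡ true → K w ≡ false → u ≢ w
  sides p q refl = true≢false p q

  extend : ∀ b K′ → Splits (induced G suc) K′ → (∀ u → K′ u ≡ b → adj G v (suc u) ≡ b) → IsSplit G
  extend b K′ (cl′ , st′) at-v = K″ , cl″ , st″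
    where
    K″ : Fin (suc n) → Bool
    K″ zero    = b
    K″ (suc u) = K′ u
    cl″ : ∀ u w → u ≢ w → K″ u ≡ true → K″ w ≡ true → u ~ w
    cl″ zero    zero    ne _ _ = contradiction refl ne
    cl″ zero    (suc w) _  refl q = at-v w q
    cl″ (suc u) zero    _  p refl = ~sym (at-v u p)
    cl″ (suc u) (suc w) ne p q = cl′ u w (ne ∘ cong suc) p q
    st″ : ∀ u w → u ≢ w → K″ u ≡ false → K″ w ≡ false → u ≁ w
    st″ zero    zero    ne _ _ = contradiction refl ne
    st″ zero    (suc w) _  refl q = at-v w q
    st″ (suc u) zero    _  p refl = ≁sym (at-v u p)
    st″ (suc u) (suc w) ne p q = st′ u w (ne ∘ cong suc) p q

  -- Maximality of `K` supplies `k′`. In the new partition `s` takes the place of `k′` in the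
  -- clique, and `v` joins the stable set.
  module Exchange-k-for-s {s k k′} (ks : K s ≡ false) (vs : v ~ suc s) (kk : K k ≡ true) (vk : v ≁ suc k)
    (sk : suc s ~ suc k) (kk′ : K k′ ≡ true) (sk′ : suc s ≁ suc k′) where

    k~k′ : suc k ~ suc k′
    k~k′ = cl (λ { refl → true≢false sk sk′ }) kk kk′

    vk′ : v ≁ suc k′
    vk′ = ¬~⇒≁ λ e → noC4 vs sk k~k′ (~sym e) vk sk′ (λ ()) (suc-≢ (sides kk′ ks ∘ sym))

    s~ : ∀ u → K u ≡ true → u ≢ k′ → suc s ~ suc u
    -- If `s` missed a further `u`, then `v s k u` would be a C4 when `v` sees `u`, and `vs` and
    -- `uk′` would be separated edges when it does not.
    s~ u ku u≢k′ = ¬≁⇒~ λ su → [ (λ vu → noC4 vs sk (cl (k≢ su) kk ku) (~sym vu) vk su (λ ()) (suc-≢ (sides ku ks ∘ sym)))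
                                   , (λ vu → no2K2 vs (cl u≢k′ ku kk′) vu vk′ su sk′) ]′ (side u)
      where
      k≢ : suc s ≁ suc u → k ≢ u
      k≢ su refl = true≢false sk su
      side : ∀ u → v ~ suc u ⊎ v ≁ suc u
      side u with adj G v (suc u)
      ... | true  = inj₁ refl
      ... | false = inj₂ refl

    v≁ : ∀ u → K u ≡ false → u ≢ s → v ≁ suc u
    -- A second stable neighbour `u` of `v` gives the C4 `v s k u`, the pentagon `v s k k′ u` or the
    -- separated edges `vu` and `kk′`.
    v≁ u ku u≢s with adj G v (suc u) in vu | adj G (suc k) (suc u) in ku′ | adj G (suc k′) (suc u) in k′u
    ... | false | _     | _     = refl
    ... | true  | true  | _     = ⊥-elim (noC4 vs sk ku′ (~sym vu) vk (st (u≢s ∘ sym) ks ku) (λ ()) (suc-≢ (u≢s ∘ sym)))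
    ... | true  | false | true  = ⊥-elim (noPentagon noC5 vs vk vk′ vu sk sk′ (st (u≢s ∘ sym) ks ku) k~k′ ku′ k′u)
    ... | true  | false | false = ⊥-elim (no2K2 vu k~k′ vk vk′ (≁sym ku′) (≁sym k′u))

    k′≁ : ∀ u → K u ≡ false → u ≢ s → suc k′ ≁ suc u
    k′≁ u ku u≢s = ¬~⇒≁ λ k′u → no2K2 vs k′u vk′ (v≁ u ku u≢s) sk′ (st (u≢s ∘ sym) ks ku)

    K₁ K₂ : Fin n → Bool
    K₁ = K [ s ↦ true ]
    K₂ = K₁ [ k′ ↦ false ]

    in-K₂ : ∀ u → K₂ u ≡ true → u ≡ s ⊎ (u ≢ k′ × K u ≡ true)
    in-K₂ u p with updated K₁ k′ false u p
    ... | inj₂ (ne , q) with updated K s true u q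
    ... | inj₁ (e , _) = inj₁ e
    ... | inj₂ (_ , r) = inj₂ (ne , r)

    out-K₂ : ∀ u → K₂ u ≡ false → u ≡ k′ ⊎ (u ≢ s × K u ≡ false)
    out-K₂ u p with updated K₁ k′ false u p
    ... | inj₁ (e , _) = inj₁ e
    ... | inj₂ (_ , q) with updated K s true u q
    ... | inj₂ (ne , r) = inj₂ (ne , r)

    result : IsSplit G
    result = extend false K₂ (cl₂ , st₂) at-v
      where
      cl₂ : ∀ u w → u ≢ w → K₂ u ≡ true → K₂ w ≡ true → suc u ~ suc w
      cl₂ u w ne p q with in-K₂ u p | in-K₂ w q
      ... | inj₁ refl     | inj₁ refl     = contradiction refl ne
      ... | inj₁ refl     | inj₂ (w≢ , r) = s~ w r w≢
      ... | inj₂ (u≢ , r) | inj₁ refl     = ~sym (s~ u r u≢)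
      ... | inj₂ (_ , r)  | inj₂ (_ , t)  = cl ne r t
      st₂ : ∀ u w → u ≢ w → K₂ u ≡ false → K₂ w ≡ false → suc u ≁ suc w
      st₂ u w ne p q with out-K₂ u p | out-K₂ w q
      ... | inj₁ refl     | inj₁ refl     = contradiction refl ne
      ... | inj₁ refl     | inj₂ (w≢ , r) = k′≁ w r w≢
      ... | inj₂ (u≢ , r) | inj₁ refl     = ≁sym (k′≁ u r u≢)
      ... | inj₂ (_ , r)  | inj₂ (_ , t)  = st ne r t
      at-v : ∀ u → K₂ u ≡ false → v ≁ suc u
      at-v u p with out-K₂ u p
      ... | inj₁ refl     = vk′
      ... | inj₂ (u≢ , r) = v≁ u r u≢

  -- A second clique vertex `u` missed by `v` would make `vs` and `uk` separated edges. Hence `k` is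
  -- the only one, and `v` takes its place in the clique.
  module Exchange-k-for-v {s k} (ks : K s ≡ false) (vs : v ~ suc s) (kk : K k ≡ true) (vk : v ≁ suc k)
    (apart : ∀ {s k} → K s ≡ false → v ~ suc s → K k ≡ true → v ≁ suc k → suc s ≁ suc k) where

    v~ : ∀ u → K u ≡ true → u ≢ k → v ~ suc u
    v~ u ku u≢k = ¬≁⇒~ λ vu → no2K2 vs (cl u≢k ku kk) vu vk (apart ks vs ku vu) (apart ks vs kk vk)

    k≁ : ∀ u → K u ≡ false → suc k ≁ suc u
    k≁ u ku with adj G (suc k) (suc u) in k~u | adj G v (suc u) in vu
    ... | false | _     = refl
    ... | true  | true  = ⊥-elim (true≢false (~sym k~u) (apart ku vu kk vk))
    ... | true  | false = ⊥-elim (no2K2 vs k~u vk vu (apart ks vs kk vk) (st (λ { refl → true≢false vs vu }) ks ku))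

    K₁ : Fin n → Bool
    K₁ = K [ k ↦ false ]

    result : IsSplit G
    result = extend true K₁ (cl₁ , st₁) at-v
      where
      cl₁ : ∀ u w → u ≢ w → K₁ u ≡ true → K₁ w ≡ true → suc u ~ suc w
      cl₁ u w ne p q with updated K k false u p | updated K k false w q
      ... | inj₂ (_ , r) | inj₂ (_ , t) = cl ne r t
      st₁ : ∀ u w → u ≢ w → K₁ u ≡ false → K₁ w ≡ false → suc u ≁ suc w
      st₁ u w ne p q with updated K k false u p | updated K k false w q
      ... | inj₁ (refl , _) | inj₁ (refl , _) = contradiction refl ne
      ... | inj₁ (refl , _) | inj₂ (_ , t)    = k≁ w t
      ... | inj₂ (_ , r)    | inj₁ (refl , _) = ≁sym (k≁ u r)
      ... | inj₂ (_ , r)    | inj₂ (_ , t)    = st ne r t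
      at-v : ∀ u → K₁ u ≡ true → v ~ suc u
      at-v u p with updated K k false u p
      ... | inj₂ (ne , r) = v~ u r ne

  split : IsSplit G
  split with any? (λ k → (K k Bool.≟ true) ×-dec (adj G v (suc k) Bool.≟ false))
           | any? (λ s → (K s Bool.≟ false) ×-dec (adj G v (suc s) Bool.≟ true))
  ... | no complete | _ = extend true K sp λ u ku → ¬-not λ e → complete (u , ku , e)
  ... | yes _ | no anticomplete = extend false K sp λ u ku → ¬-not λ e → anticomplete (u , ku , e)
  ... | yes (k , kk , vk) | yes (s , ks , vs)
    with any? (λ s → any? (λ k → (K s Bool.≟ false) ×-dec (adj G v (suc s) Bool.≟ true) ×-dec
           (K k Bool.≟ true) ×-dec (adj G v (suc k) Bool.≟ false) ×-dec (adj G (suc s) (suc k) Bool.≟ true)))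
  ... | no apart = Exchange-k-for-v.result ks vs kk vk λ ks vs kk vk → ¬-not λ e → apart (_ , _ , ks , vs , kk , vk , e)
  ... | yes (s , k , ks , vs , kk , vk , sk) with mx s ks
  ... | k′ , kk′ , sk′ = Exchange-k-for-s.result ks vs kk vk sk kk′ sk′

foldes-hammer : ∀ {n} (G : Graph n) → No2K2 G → NoC4 G → NoC5 G → IsSplit G
foldes-hammer {zero}  G _ _ _ = (λ ()) , (λ ()) , (λ ())
foldes-hammer {suc n} G no2K2 noC4 noC5 with foldes-hammer (induced G suc) no2K2
    (λ p q r s t w a≢c b≢d → noC4 p q r s t w (λ { refl → a≢c refl }) (λ { refl → b≢d refl })) (λ c → noC5 (suc ∘ c))
... | K , cl , st with enlarge (induced G suc) K (cl , st)
... | K′ , sp , mx = AddVertex.split G no2K2 noC4 noC5 K′ sp mx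

-- Subsets and minimality

comprehension : ∀ {n} {P : Fin n → Set} → (∀ v → Dec (P v)) → Subset n
comprehension P? = tabulate (does ∘ P?)

∈-comprehension⁺ : ∀ {n} {P : Fin n → Set} (P? : ∀ v → Dec (P v)) {v} → P v → v ∈ comprehension P?
∈-comprehension⁺ P? {v} p = lookup⇒[]= v _ (trans (lookup∘tabulate (does ∘ P?) v) (dec-true (P? v) p))

∈-comprehension⁻ : ∀ {n} {P : Fin n → Set} (P? : ∀ v → Dec (P v)) {v} → v ∈ comprehension P? → P v
∈-comprehension⁻ P? {v} v∈ with P? v | trans (sym (lookup∘tabulate (does ∘ P?) v)) ([]=⇒lookup v∈)
... | yes p | _ = p

-- Vertices are deleted one at a time while `P` survives, so minimality refers to the deletion of a
-- single vertex.
shrink : ∀ {n} {P : Subset n → Set} → (∀ X → Dec (P X)) → ∀ X → P X →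
  ∃ λ Y → Y ⊆ X × P Y × (∀ x → x ∈ Y → ¬ P (Y - x))
shrink {n} {P} P? X = go X (<-wellFounded ∣ X ∣)
  where
  go : ∀ X → Acc _<_ ∣ X ∣ → P X → ∃ λ Y → Y ⊆ X × P Y × (∀ x → x ∈ Y → ¬ P (Y - x))
  go X (acc rs) p with any? (λ x → (x ∈? X) ×-dec P? (X - x))
  ... | no minimal = X , id , p , λ x x∈ p′ → minimal (x , x∈ , p′)
  ... | yes (x , x∈ , p′) with go (X - x) (rs (x∈p⇒∣p-x∣<∣p∣ x∈)) p′
  ... | Y , Y⊆ , rest = Y , p─q⊆p X _ ∘ Y⊆ , rest

-- Components outside a set of vertices

module Cutset {n} (G : Graph n) (X : Subset n) where
  open Notation G

  Closed : Subset n → Set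
  Closed D = ∀ u v → u ∉ X → v ∉ X → u ∈ D → u ~ v → v ∈ D

  closed? : ∀ D → Dec (Closed D)
  closed? D = ∀Fin? λ u → ∀Fin? λ v → ¬? (u ∈? X) →-dec (¬? (v ∈? X) →-dec
    ((u ∈? D) →-dec ((adj G u v Bool.≟ true) →-dec (v ∈? D))))

  -- Closed sets take the place of paths, so that connectivity in G - X is decided by a search over
  -- subsets.
  Separated : Fin n → Fin n → Set
  Separated u v = ∃ λ D → Closed D × u ∈ D × v ∉ D

  separated? : ∀ u v → Dec (Separated u v)
  separated? u v = anySubset? λ D → closed? D ×-dec (u ∈? D) ×-dec ¬? (v ∈? D)

  Connected : Fin n → Fin n → Set
  Connected u v = ¬ Separated u v

  sep-sym : ∀ {u v} → Separated u v → Separated v u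
  sep-sym (D , cl , u∈ , v∉) = ∁ D ,
    (λ a b a∉ b∉ a∈ a~b → x∉p⇒x∈∁p λ b∈ → x∈∁p⇒x∉p a∈ (cl b a b∉ a∉ b∈ (~sym a~b))) ,
    x∉p⇒x∈∁p v∉ , x∈p⇒x∉∁p u∈

  -- The closed set contains `w` or it does not. This cotransitivity makes `Connected` transitive.
  sep-split : ∀ {u v} w → Separated u v → Separated u w ⊎ Separated w v
  sep-split w (D , cl , u∈ , v∉) with w ∈? D
  ... | yes w∈ = inj₂ (D , cl , w∈ , v∉)
  ... | no w∉  = inj₁ (D , cl , u∈ , w∉)

  sep-irr : ∀ {u} → ¬ Separated u u
  sep-irr (_ , _ , u∈ , u∉) = u∉ u∈

  sep-≁ : ∀ {u v} → u ∉ X → v ∉ X → Separated u v → u ≁ v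
  sep-≁ u∉ v∉ (_ , cl , u∈D , v∉D) = ¬~⇒≁ λ e → v∉D (cl _ _ u∉ v∉ u∈D e)

  sep-connʳ : ∀ {u v w} → Separated u v → Connected v w → Separated u w
  sep-connʳ {w = w} s c = [ id , (λ s′ → contradiction (sep-sym s′) c) ]′ (sep-split w s)

  sep-connˡ : ∀ {u v w} → Separated u v → Connected u w → Separated w v
  sep-connˡ s c = sep-sym (sep-connʳ (sep-sym s) c)

  In : Fin n → Fin n → Set
  In p v = v ∉ X × Connected p v

  in? : ∀ p v → Dec (In p v)
  in? p v = ¬? (v ∈? X) ×-dec ¬? (separated? p v)

  in-step : ∀ {p u v} → In p u → v ∉ X → u ~ v → In p v
  in-step (u∉ , c) v∉ u~v = v∉ , λ s → [ c , (λ s′ → true≢false u~v (sep-≁ u∉ v∉ s′)) ]′ (sep-split _ s)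

  -- If `P` failed at `b`, the vertices of the component with `P` would form a closed set separating
  -- `a` from `b`.
  in-induction : ∀ {p} (P : Fin n → Set) → (∀ v → Dec (P v)) →
    (∀ {u v} → In p u → In p v → P u → u ~ v → P v) → ∀ {a b} → In p a → P a → In p b → P b
  in-induction {p} P P? spread {a} {b} ina pa inb with P? b
  ... | yes pb = pb
  ... | no ¬pb = contradiction (sep-connˡ sep-ab (proj₂ ina ∘ sep-sym)) (proj₂ inb)
    where
    Q? : ∀ v → Dec (In p v × P v)
    Q? v = in? p v ×-dec P? v
    sep-ab : Separated a b
    sep-ab = comprehension Q? ,
      (λ u v u∉ v∉ u∈ u~v → let inu , pu = ∈-comprehension⁻ Q? u∈ ; inv = in-step inu v∉ u~v
                            in ∈-comprehension⁺ Q? (inv , spread inu inv pu u~v)) ,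
      ∈-comprehension⁺ Q? (ina , pa) , λ b∈ → ¬pb (proj₂ (∈-comprehension⁻ Q? b∈))

  -- The component of `v` in G - X has an edge exactly when `v` has a neighbour there.
  Nontrivial : Fin n → Set
  Nontrivial v = v ∉ X × ∃ λ w → w ∉ X × v ~ w

  nontrivial? : ∀ v → Dec (Nontrivial v)
  nontrivial? v = ¬? (v ∈? X) ×-dec any? λ w → ¬? (w ∈? X) ×-dec (adj G v w Bool.≟ true)

  in-self : ∀ {p} → Nontrivial p → In p p
  in-self (p∉ , _) = p∉ , sep-irr

  in-nontrivial : ∀ {p a} → Nontrivial p → In p a → Nontrivial a
  in-nontrivial nt = in-induction Nontrivial nontrivial?
    (λ inu inv _ u~v → proj₁ inv , _ , proj₁ inu , ~sym u~v) (in-self nt) nt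

  Cut : Set
  Cut = ∃ λ p → ∃ λ q → Nontrivial p × Nontrivial q × Separated p q

  cut? : Dec Cut
  cut? = any? λ p → any? λ q → nontrivial? p ×-dec nontrivial? q ×-dec separated? p q

  Miss : Fin n → Fin n → Set
  Miss x p = ∃ λ a → In p a × x ≁ a

  miss? : ∀ x p → Dec (Miss x p)
  miss? x p = any? λ a → in? p a ×-dec (adj G x a Bool.≟ false)

  hits : ∀ {x p a} → ¬ Miss x p → In p a → x ~ a
  hits ¬m ina = ¬≁⇒~ λ e → ¬m (_ , ina , e)

-- Minimal cutsets

open Cutset using (Cut; cut?)

-- The components of G − X with an edge are considered for a cutset X which is inclusion-minimal
-- among those leaving at least two of them.
module MinimalCutset {n} (G : Graph n) (X : Subset n) (free : PFree G) (noC5 : NoC5 G)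
  (cut : Cut G X) (minimal : ∀ x → x ∈ X → ¬ Cut G (X - x)) where
  open Notation G
  open Forbidden G
  open Cutset G X hiding (Cut; cut?)

  another-component : ∀ p → ∃ λ q → Nontrivial q × Separated p q
  another-component p = let d , e , nd , ne , s = cut in
    [ (λ s′ → d , nd , sep-sym s′) , (λ s′ → e , ne , s′) ]′ (sep-split p s)

  apart : ∀ {p q a c} → Separated p q → In p a → In q c → a ≁ c
  apart s (a∉ , pa) (c∉ , qc) = sep-≁ a∉ c∉ (sep-connˡ (sep-connʳ s qc) pa)

  -- Without such a neighbour the component of `p` would stay closed when `x` returns to the graph,
  -- and `X - x` would still be a cutset.
  neighbour-in : ∀ {x p} → x ∈ X → Nontrivial p → ∃ λ a → In p a × x ~ a
  neighbour-in {x} {p} x∈ np@(p∉ , p′ , p′∉ , pp′) with any? (λ a → in? p a ×-dec (adj G x a Bool.≟ true))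
  ... | yes r = r
  ... | no none with another-component p
  ... | q , (q∉ , q′ , q′∉ , qq′) , s = contradiction
      (p , q , (out p∉ , p′ , out p′∉ , pp′) , (out q∉ , q′ , out q′∉ , qq′) ,
       comprehension (in? p) , closed , ∈-comprehension⁺ (in? p) (in-self np) ,
       λ q∈ → proj₂ (∈-comprehension⁻ (in? p) q∈) s)
      (minimal x x∈)
    where
    out : ∀ {v} → v ∉ X → v ∉ X - x
    out v∉ v∈ = v∉ (p─q⊆p X _ v∈)
    closed : Cutset.Closed G (X - x) (comprehension (in? p))
    closed u v _ v∉ u∈ u~v with v ≟ x | ∈-comprehension⁻ (in? p) u∈
    ... | yes refl | inu = contradiction (u , inu , ~sym u~v) none
    ... | no v≢x   | inu = ∈-comprehension⁺ (in? p) (in-step inu (λ v∈ → v∉ (x∈p∧x≢y⇒x∈p-y v∈ v≢x)) u~v)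

  mixed-edge : ∀ {x p} → x ∈ X → Nontrivial p → Miss x p →
    ∃ λ a → ∃ λ a′ → In p a × In p a′ × a ~ a′ × x ~ a × x ≁ a′
  mixed-edge {x} {p} x∈ np (b , inb , xb) with any? (λ a → any? (λ a′ → in? p a ×-dec in? p a′ ×-dec
    (adj G a a′ Bool.≟ true) ×-dec (adj G x a Bool.≟ true) ×-dec (adj G x a′ Bool.≟ false)))
  ... | yes r = r
  ... | no none with neighbour-in x∈ np
  ... | a , ina , xa = ⊥-elim (true≢false (in-induction (x ~_) (λ v → adj G x v Bool.≟ true)
          (λ inu inv xu uv → ¬≁⇒~ λ xv → none (_ , _ , inu , inv , uv , xu , xv)) ina xa inb) xb)

  -- Mixed edges `a a′` and `c c′` in two components would give the path `a′ a x c c′`.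
  complete-elsewhere : ∀ {x p q c} → x ∈ X → Nontrivial p → Nontrivial q → Separated p q →
    Miss x p → In q c → x ~ c
  complete-elsewhere x∈ np nq s m inc = ¬≁⇒~ λ xc → P5-through (mixed-edge x∈ np m) (mixed-edge x∈ nq (_ , inc , xc))
    where
    P5-through : _ → _ → ⊥
    P5-through (a , a′ , ina , ina′ , aa′ , xa , xa′) (c , c′ , inc , inc′ , cc′ , xc , xc′) =
      noP5 free (~sym aa′) (≁sym xa′) (apart s ina′ inc) (apart s ina′ inc′) (~sym xa)
        (apart s ina inc) (apart s ina inc′) xc xc′ cc′

  -- If `w` were complete to the component, a mixed edge `a a′` for `u` and a neighbour `c` of `w`
  -- elsewhere would give the path `w u a′ c a` in the complement.
  miss-together : ∀ {u w p} → u ∈ X → w ∈ X → u ≁ w → Nontrivial p → Miss u p → Miss w p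
  miss-together {u} {w} {p} u∈ w∈ uw np m with miss? w p
  ... | yes m′ = m′
  ... | no ¬m with another-component p
  ... | q , nq , s with mixed-edge u∈ np m | neighbour-in w∈ nq
  ... | a , a′ , ina , ina′ , aa′ , ua , ua′ | c , inc , wc =
    ⊥-elim (noCoP5 free (≁sym uw) (hits ¬m ina′) wc (hits ¬m ina) ua′
      (complete-elsewhere u∈ np nq s m inc) ua (apart s ina′ inc) (~sym aa′) (≁sym (apart s ina inc)))

  -- If `w` misses `p`, then `u` and `w` are both complete to another component. The property of
  -- being seen by `u` and missed by `w` now spreads from `p` over its component, where `w` has a
  -- neighbour.
  unmixed : ∀ {u w p} → u ∈ X → w ∈ X → u ≁ w → Nontrivial p → u ~ p → w ~ p
  unmixed {u} {w} {p} u∈ w∈ uw np up with another-component p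
  ... | q , nq , s = ¬≁⇒~ λ wp → contra wp (neighbour-in w∈ np)
    where
    module _ (wp : w ≁ p) where
      w-misses : Miss w p
      w-misses = p , in-self np , wp
      uq : u ~ q
      uq = complete-elsewhere u∈ np nq s (miss-together w∈ u∈ (≁sym uw) np w-misses) (in-self nq)
      wq : w ~ q
      wq = complete-elsewhere w∈ np nq s w-misses (in-self nq)
      spread : ∀ {v v′} → In p v → In p v′ → u ~ v × w ≁ v → v ~ v′ → u ~ v′ × w ≁ v′
      spread {v} {v′} inv inv′ (uv , wv) vv′ with apart s inv (in-self nq) | apart s inv′ (in-self nq)
         | adj G u v′ in uv′ | adj G w v′ in wv′
      ... | _  | _   | true  | false = refl , refl
      -- The three bad cases give the path `u w v q v′` of the complement, the pentagon `q u v v′ w`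
      -- and the path `v′ v u q w`.
      ... | vq | v′q | true  | true  = ⊥-elim (noCoP5 free uw uv uq uv′ wv wq wv′ vq vv′ (≁sym v′q))
      ... | vq | v′q | false | true  = ⊥-elim (noPentagon noC5 (~sym uq) (≁sym vq) (≁sym v′q) (~sym wq)
                                         uv uv′ uw vv′ (≁sym wv) (~sym wv′))
      ... | vq | v′q | false | false = ⊥-elim (noP5 free (~sym vv′) (≁sym uv′) v′q (≁sym wv′)
                                         (~sym uv) vq (≁sym wv) uq uw (~sym wq))
      contra : (∃ λ b → In p b × w ~ b) → ⊥
      contra (b , inb , wb) = true≢false wb (proj₂ (in-induction (λ v → u ~ v × w ≁ v)
        (λ v → (adj G u v Bool.≟ true) ×-dec (adj G w v Bool.≟ false)) spread (in-self np) (up , wp) inb))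

  -- Otherwise the vertices missed by `l` without a neighbour seen by `l` fill the component: where
  -- this stops spreading, `v v′ w l c` is a path, with `c` in another component.
  towards : ∀ {l p a} → l ∈ X → Nontrivial p → In p a → l ≁ a → ∃ λ a′ → In p a′ × a ~ a′ × l ~ a′
  towards {l} {p} {a} l∈ np ina la = decidable-stable (towards? a) λ none →
    let b , inb , lb = neighbour-in l∈ np
    in true≢false lb (proj₁ (in-induction (λ v → l ≁ v × ¬ Towards v)
         (λ v → (adj G l v Bool.≟ false) ×-dec ¬? (towards? v)) carry ina (la , none) inb))
    where
    Towards : Fin n → Set
    Towards v = ∃ λ a′ → In p a′ × v ~ a′ × l ~ a′
    towards? : ∀ v → Dec (Towards v)
    towards? v = any? λ a′ → in? p a′ ×-dec (adj G v a′ Bool.≟ true) ×-dec (adj G l a′ Bool.≟ true)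
    carry : ∀ {v v′} → In p v → In p v′ → l ≁ v × ¬ Towards v → v ~ v′ → l ≁ v′ × ¬ Towards v′
    carry {v} {v′} inv inv′ (lv , none) vv′ = lv′ , λ { (w , inw , v′w , lw) → long w inw v′w lw }
      where
      lv′ : l ≁ v′
      lv′ = ¬~⇒≁ λ e → none (v′ , inv′ , vv′ , e)
      long : ∀ w → In p w → v′ ~ w → l ~ w → ⊥
      long w inw v′w lw with another-component p
      ... | q , nq , s with neighbour-in l∈ nq
      ... | c , inc , lc = noP5 free vv′ (¬~⇒≁ λ e → none (w , inw , e , lw)) (≁sym lv) (apart s inv inc)
        v′w (≁sym lv′) (apart s inv′ inc) (~sym lw) (apart s inw inc) lc

  -- The vertices are treated one by one. When `l` misses the current `a`, a neighbour `a′` of `a`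
  -- seen by `l` replaces it, and the vertices of `X` already treated see `a′` too.
  complete-vertex : ∀ {p} → Nontrivial p → ∃ λ a → In p a × (∀ {x} → x ∈ X → x ~ a)
  complete-vertex {p} np = let a , ina , good = go (allFin n) in a , ina , good (∈-allFin _)
    where
    go : ∀ xs → ∃ λ a → In p a × (∀ {x} → x ∈ₗ xs → x ∈ X → x ~ a)
    go [] = p , in-self np , λ ()
    go (l ∷ xs) with go xs
    ... | a , ina , good with l ∈? X | adj G l a in la
    ... | no l∉  | _ = a , ina , λ { (Any.here refl) x∈ → contradiction x∈ l∉ ; (Any.there i) x∈ → good i x∈ }
    ... | yes _  | true = a , ina , λ { (Any.here refl) _ → la ; (Any.there i) x∈ → good i x∈ }
    ... | yes l∈ | false with towards l∈ np ina la | another-component p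
    ... | a′ , ina′ , aa′ , la′ | q , nq , s = a′ , ina′ ,
      λ { (Any.here refl) _ → la′ ; (Any.there i) x∈ → keep x∈ (good i x∈) }
      where
      keep : ∀ {x} → x ∈ X → x ~ a → x ~ a′
      keep {x} x∈ xa = ¬≁⇒~ λ xa′ → clash xa′
        where
        clash : x ≁ a′ → ⊥
        -- If `x` misses `l`, then `unmixed` makes `l` see `a`; otherwise `l a q a′ x` is a path of
        -- the complement.
        clash xa′ with adj G l x in lx
        ... | false = true≢false (unmixed x∈ l∈ (≁sym lx) (in-nontrivial np ina) xa) la
        ... | true  = noCoP5 free la (complete-elsewhere l∈ np nq s (a , ina , la) (in-self nq)) la′ lx
          (apart s ina (in-self nq)) aa′ (~sym xa) (≁sym (apart s ina′ (in-self nq)))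
          (~sym (complete-elsewhere x∈ np nq s (a′ , ina′ , xa′) (in-self nq))) (≁sym xa′)

-- The division given by a minimal cutset

module Division {n} (G : Graph n) (X : Subset n) (free : PFree G) (noC5 : NoC5 G)
  (minimal : ∀ x → x ∈ X → ¬ Cut G (X - x))
  {p q : Fin n} (np : Cutset.Nontrivial G X p) (nq : Cutset.Nontrivial G X q) (pq : Cutset.Separated G X p q)
  -- Adjacency is asked only between vertices mixed on the component of `p`, which also covers the
  -- cutset found in the complement.
  (clique : ∀ {x y} → x ∈ X → y ∈ X → x ≢ y → Cutset.Miss G X x p → Cutset.Miss G X y p → adj G x y ≡ true) where
  open Notation G
  open Cutset G X hiding (Cut; cut?)
  open MinimalCutset G X free noC5 (p , q , np , nq , pq) minimal

  Meaning : Lab → Fin n → Set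
  Meaning lA v = In p v
  Meaning lB v = v ∈ X × ¬ Miss v p
  Meaning lC v = Nontrivial v × Separated p v
  Meaning lL v = v ∈ X × Miss v p
  Meaning lT v = v ∉ X × ¬ Nontrivial v

  classify : ∀ v → ∃ λ l → Meaning l v
  classify v with v ∈? X
  ... | yes v∈ with miss? v p
  ... | yes m  = lL , v∈ , m
  ... | no ¬m  = lB , v∈ , ¬m
  classify v | no v∉ with separated? p v
  ... | no c = lA , v∉ , c
  ... | yes s with nontrivial? v
  ... | yes nv = lC , nv , s
  ... | no ¬nv = lT , v∉ , ¬nv

  lab : Fin n → Lab
  lab v = proj₁ (classify v)

  meaning : ∀ {v l} → lab v ≡ l → Meaning l v
  meaning {v} refl = proj₂ (classify v)

  in⇒lA : ∀ {v} → In p v → lab v ≡ lA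
  in⇒lA {v} inv@(v∉ , c) with lab v in e | meaning {v} refl
  ... | lA | _        = refl
  ... | lB | v∈ , _   = contradiction v∈ v∉
  ... | lC | _ , s    = contradiction s c
  ... | lL | v∈ , _   = contradiction v∈ v∉
  ... | lT | _ , ¬nv  = contradiction (in-nontrivial np inv) ¬nv

  in⇒lC : ∀ {v} → In q v → lab v ≡ lC
  in⇒lC {v} inv@(v∉ , c) with lab v in e | meaning {v} refl
  ... | lA | _ , c′   = contradiction (sep-connʳ pq c) c′
  ... | lB | v∈ , _   = contradiction v∈ v∉
  ... | lC | _        = refl
  ... | lL | v∈ , _   = contradiction v∈ v∉
  ... | lT | _ , ¬nv  = contradiction (in-nontrivial nq inv) ¬nv

  off-X : ∀ {l v} → lab v ≡ l → isBL l ≡ false → v ∉ X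
  off-X {lA} e _ = proj₁ (meaning e)
  off-X {lC} e _ = proj₁ (proj₁ (meaning e))
  off-X {lT} e _ = proj₁ (meaning e)

  in-X : ∀ {l v} → lab v ≡ l → isBL l ≡ true → v ∈ X
  in-X {lB} e _ = proj₁ (meaning e)
  in-X {lL} e _ = proj₁ (meaning e)

  isolated : ∀ {t v} → lab t ≡ lT → v ∉ X → t ≁ v
  isolated e v∉ = ¬~⇒≁ λ tv → proj₂ (meaning e) (proj₁ (meaning e) , _ , v∉ , tv)

  AC : ∀ {a c} → lab a ≡ lA → lab c ≡ lC → a ≁ c
  AC ea ec = apart (proj₂ (meaning ec)) (meaning ea) (in-self (proj₁ (meaning ec)))

  -- Consecutive vertices of an antipath in B are nonadjacent members of `X`, so `unmixed` gives
  -- them the same neighbours in C.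
  anticomponent-unmixed : ∀ {c b b₁} → lab c ≡ lC → AntiReach G lab b b₁ → adj G c b ≡ adj G c b₁
  anticomponent-unmixed ec (here _) = refl
  anticomponent-unmixed {c} ec (step {v = v} {w = w} r lw v≢w vw) = trans (anticomponent-unmixed ec r) same
    where
    end : ∀ {b b₁} → AntiReach G lab b b₁ → lab b₁ ≡ lB
    end (here e)         = e
    end (step _ e _ _)   = e
    pass : ∀ {u w} → lab u ≡ lB → lab w ≡ lB → u ≁ w → c ~ u → c ~ w
    pass lu lw uw cu = ~sym (unmixed (in-X lu refl) (in-X lw refl) uw (proj₁ (meaning ec)) (~sym cu))
    same : adj G c v ≡ adj G c w
    same with adj G c v in cv | adj G c w in cw
    ... | true  | true  = refl
    ... | false | false = refl
    ... | true  | false = trans (sym (pass (end r) lw vw cv)) cw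
    ... | false | true  = trans (sym cv) (pass lw (end r) (≁sym vw) cw)

  splitUnification : BySplitUnification G
  splitUnification with complete-vertex np | complete-vertex nq
  ... | a , ina , a-compl | c , inc , c-compl with in-nontrivial np ina | in-nontrivial nq inc
  ... | a∉ , a′ , a′∉ , aa′ | c∉ , c′ , c′∉ , cc′ =
    lab , (a , la) , (c , lc) ,
    (λ u v u≢v lu lv → clique (in-X lu refl) (in-X lv refl) u≢v (proj₂ (meaning lu)) (proj₂ (meaning lv))) ,
    (λ u v _ lu lv → isolated lu (off-X lv refl)) ,
    (λ u v lu lv → ~sym (hits (proj₂ (meaning lv)) (meaning lu))) ,
    (λ u v lu lv → ≁sym (isolated lv (off-X lu refl))) ,
    (a , la , λ l ll → ~sym (a-compl (in-X ll refl))) ,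
    (λ t v lt lv → isolated lt (off-X lv refl)) ,
    -- A nonneighbour in B of a vertex of L would miss A together with it.
    (λ u v lu lv → ¬≁⇒~ λ uv → proj₂ (meaning lv)
      (miss-together (in-X lu refl) (in-X lv refl) uv np (proj₂ (meaning lu)))) ,
    (λ u v lu lv → complete-elsewhere (in-X lu refl) np (proj₁ (meaning lv)) (proj₂ (meaning lv))
      (proj₂ (meaning lu)) (in-self (proj₁ (meaning lv)))) ,
    (c , lc , λ b lb → ~sym (c-compl (in-X lb refl))) ,
    (λ { u b lu _ (b₁ , b₂ , r₁ , r₂ , e₁ , e₂) → true≢false
      (trans (sym (anticomponent-unmixed lu r₂)) (trans (anticomponent-unmixed lu r₁) e₁)) e₂ }) ,
    (λ u v lu lv → AC lu lv) ,
    -- Being complete to `X`, the vertices `c` and `a` act as c* and a*; a neighbour of each in its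
    -- component is left out.
    contraction-smaller G (G1-contraction G lab) free c c′ lc (in⇒lC (in-step inc c′∉ cc′)) (~⇒≢ cc′) like-c ,
    contraction-smaller G (G2-contraction G lab) free a a′ la (in⇒lA (in-step ina a′∉ aa′)) (~⇒≢ aa′) like-a
    where
    la : lab a ≡ lA
    la = in⇒lA ina
    lc : lab c ≡ lC
    lc = in⇒lC inc
    like-c : ∀ v → lab v ≢ lC → adj G c v ≡ isBL (lab v)
    like-c v ne with lab v in e
    ... | lA = ≁sym (AC e lc)
    ... | lB = ~sym (c-compl (in-X e refl))
    ... | lC = contradiction refl ne
    ... | lL = ~sym (c-compl (in-X e refl))
    ... | lT = ≁sym (isolated e c∉)
    like-a : ∀ v → lab v ≢ lA → adj G a v ≡ isBL (lab v)
    like-a v ne with lab v in e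
    ... | lA = contradiction refl ne
    ... | lB = ~sym (a-compl (in-X e refl))
    ... | lC = AC la e
    ... | lL = ~sym (a-compl (in-X e refl))
    ... | lT = ≁sym (isolated e a∉)

-- If the minimal cutset X of G contains two nonadjacent vertices u and w, then in the complement H the
-- edge uw and the edge between the vertices a and c of the two components that are complete to X are
-- separated by the rest of the graph. Shrinking that rest to a minimal cutset Y of H only adds vertices to
-- the component of a, so that another component K lies in X. By `unmixed`, a vertex of Y which misses a
-- vertex of K is isolated in G − X, so these vertices form a clique of H.
module InComplement {n} (G H : Graph n) (GH : Complementary G H)
  (freeG : PFree G) (freeH : PFree H) (noC5G : NoC5 G) (noC5H : NoC5 H) (X : Subset n)
  (minimal : ∀ x → x ∈ X → ¬ Cut G (X - x))
  {p q : Fin n} (np : Cutset.Nontrivial G X p) (nq : Cutset.Nontrivial G X q) (pq : Cutset.Separated G X p q)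
  {u w : Fin n} (u∈ : u ∈ X) (w∈ : w ∈ X) (u≢w : u ≢ w) (uw : adj G u w ≡ false) where
  private
    module NG = Notation G
    module NH = Notation H
    module G = Cutset G X
    module MG = MinimalCutset G X freeG noC5G (p , q , np , nq , pq) minimal

  open NG using (_~_; _≁_)
  open NH using () renaming (_~_ to _~ʰ_; _≁_ to _≁ʰ_)

  ≁⇒~ʰ : ∀ {x y} → x ≢ y → x ≁ y → x ~ʰ y
  ≁⇒~ʰ ne e = trans (GH ne) (cong not e)

  ~ʰ⇒≁ : ∀ {x y} → x ~ʰ y → x ≁ y
  ~ʰ⇒≁ e = trans (Complementary-sym {G = G} {H} GH (NH.~⇒≢ e)) (cong not e)

  ≁ʰ⇒~ : ∀ {x y} → x ≢ y → x ≁ʰ y → x ~ y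
  ≁ʰ⇒~ ne e = trans (Complementary-sym {G = G} {H} GH ne) (cong not e)

  module _ {a c : Fin n} (ina : G.In p a) (inc : G.In q c)
           (a-compl : ∀ {x} → x ∈ X → x ~ a) (c-compl : ∀ {x} → x ∈ X → x ~ c) where

    a≢c : a ≢ c
    a≢c refl = G.sep-irr (G.sep-connʳ (G.sep-connˡ pq (proj₂ ina)) (proj₂ inc))

    a~ʰc : a ~ʰ c
    a~ʰc = ≁⇒~ʰ a≢c (MG.apart pq ina inc)

    Rest : Fin n → Set
    Rest v = v ∉ X × v ≢ a × v ≢ c

    rest? : ∀ v → Dec (Rest v)
    rest? v = ¬? (v ∈? X) ×-dec ¬? (v ≟ a) ×-dec ¬? (v ≟ c)

    Y₀ : Subset n
    Y₀ = comprehension rest?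

    a∉Y₀ : a ∉ Y₀
    a∉Y₀ a∈ = proj₁ (proj₂ (∈-comprehension⁻ rest? a∈)) refl

    c∉Y₀ : c ∉ Y₀
    c∉Y₀ c∈ = proj₂ (proj₂ (∈-comprehension⁻ rest? c∈)) refl

    X∉Y₀ : ∀ {x} → x ∈ X → x ∉ Y₀
    X∉Y₀ x∈ x∈Y = proj₁ (∈-comprehension⁻ rest? x∈Y) x∈

    -- In `G` both `a` and `c` are complete to `X`, so in `H` they form a component outside `Y₀`,
    -- away from the edge `uw`.
    cut₀ : Cut H Y₀
    cut₀ = a , u , (a∉Y₀ , c , c∉Y₀ , a~ʰc) , (X∉Y₀ u∈ , w , X∉Y₀ w∈ , ≁⇒~ʰ u≢w uw) ,
      comprehension pair? , closed , ∈-comprehension⁺ pair? (inj₁ refl) ,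
      λ u∈D → [ (λ { refl → proj₁ ina u∈ }) , (λ { refl → proj₁ inc u∈ }) ]′ (∈-comprehension⁻ pair? u∈D)
      where
      pair? : ∀ v → Dec (v ≡ a ⊎ v ≡ c)
      pair? v = (v ≟ a) ⊎-dec (v ≟ c)
      full : ∀ {x z} → x ≡ a ⊎ x ≡ c → z ∈ X → z ~ x
      full (inj₁ refl) = a-compl
      full (inj₂ refl) = c-compl
      closed : Cutset.Closed H Y₀ (comprehension pair?)
      closed x z _ z∉ x∈ xz with z ≟ a | z ≟ c | z ∈? X
      ... | yes e | _     | _      = ∈-comprehension⁺ pair? (inj₁ e)
      ... | no _  | yes e | _      = ∈-comprehension⁺ pair? (inj₂ e)
      ... | no z≢a | no z≢c | no z∉X = contradiction (∈-comprehension⁺ rest? (z∉X , z≢a , z≢c)) z∉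
      ... | no _  | no _  | yes z∈X = ⊥-elim (true≢false (NG.~sym (full (∈-comprehension⁻ pair? x∈) z∈X)) (~ʰ⇒≁ xz))

    module _ (Y : Subset n) (Y⊆ : Y ⊆ Y₀) (minimalY : ∀ y → y ∈ Y → ¬ Cut H (Y - y))
             {e} (ne : Cutset.Nontrivial H Y e) (ae : Cutset.Separated H Y a e) where
      private module H = Cutset H Y

      off-X : ∀ {y} → y ∈ Y → y ∉ X
      off-X y∈ = proj₁ (∈-comprehension⁻ rest? (Y⊆ y∈))

      na : H.Nontrivial a
      na = a∉Y₀ ∘ Y⊆ , c , c∉Y₀ ∘ Y⊆ , a~ʰc

      conn-ac : H.Connected a c
      conn-ac = proj₂ (H.in-step (H.in-self na) (c∉Y₀ ∘ Y⊆) a~ʰc)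

      module MH = MinimalCutset H Y freeH noC5H (a , e , na , ne , ae) minimalY

      -- A vertex outside `X` is separated from `a` or from `c` in G - X, hence adjacent to one of
      -- them in `H`; outside `Y` this puts it into the component of `a`.
      in-e⇒X : ∀ {z} → H.In e z → z ∈ X
      in-e⇒X {z} inz with z ∈? X
      ... | yes z∈ = z∈
      ... | no z∉ with G.separated? p z
      ... | yes s = contradiction (H.sep-sym ae) (λ s′ → proj₂ inz (H.sep-connʳ s′ conn-az))
        where
        sep-az : G.Separated a z
        sep-az = G.sep-connˡ s (proj₂ ina)
        conn-az : H.Connected a z
        conn-az = proj₂ (H.in-step (H.in-self na) (proj₁ inz)
          (≁⇒~ʰ (λ { refl → G.sep-irr sep-az }) (G.sep-≁ (proj₁ ina) z∉ sep-az)))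
      ... | no conn = contradiction (H.sep-sym ae) (λ s′ → proj₂ inz (H.sep-connʳ s′ conn-az))
        where
        sep-cz : G.Separated c z
        sep-cz = G.sep-connʳ (G.sep-connˡ (G.sep-sym pq) (proj₂ inc)) conn
        conn-az : H.Connected a z
        conn-az = proj₂ (H.in-step (c∉Y₀ ∘ Y⊆ , conn-ac) (proj₁ inz)
          (≁⇒~ʰ (λ { refl → G.sep-irr sep-cz }) (G.sep-≁ (proj₁ inc) z∉ sep-cz)))

      -- A mixed edge of `H` for `y` is a nonadjacent pair of `X` in `G` that `y` tells apart,
      -- against `unmixed` if `y` has an edge in G - X.
      missing-trivial : ∀ {y} → y ∈ Y → H.Miss y e → ¬ G.Nontrivial y
      missing-trivial {y} y∈ m ny with MH.mixed-edge y∈ ne m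
      ... | v , v′ , inv , inv′ , vv′ , yv , yv′ = true≢false
        (NG.~sym (MG.unmixed (in-e⇒X inv′) (in-e⇒X inv) (NG.≁sym (~ʰ⇒≁ vv′)) ny
          (NG.~sym (≁ʰ⇒~ (λ { refl → off-X y∈ (in-e⇒X inv′) }) yv′))))
        (~ʰ⇒≁ yv)

      clique : ∀ {x y} → x ∈ Y → y ∈ Y → x ≢ y → H.Miss x e → H.Miss y e → x ~ʰ y
      clique x∈ y∈ x≢y m _ = ≁⇒~ʰ x≢y (NG.¬~⇒≁ λ xy →
        missing-trivial x∈ m (off-X x∈ , _ , off-X y∈ , xy))

      result : BySplitUnification H
      result = Division.splitUnification H Y freeH noC5H minimalY ne na (H.sep-sym ae) clique

  splitUnification : BySplitUnification H
  splitUnification with MG.complete-vertex np | MG.complete-vertex nq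
  ... | a , ina , a-compl | c , inc , c-compl
    with shrink (λ Y → cut? H Y) (Y₀ ina inc a-compl c-compl) (cut₀ ina inc a-compl c-compl)
  -- The component of `a` cannot contain both `d` and `e`; one outside it serves as the second
  -- component.
  ... | Y , Y⊆ , (d , e , nd , ne , s) , minimalY with Cutset.sep-split H Y a s
  ... | inj₁ da = result ina inc a-compl c-compl Y Y⊆ minimalY nd (Cutset.sep-sym H Y da)
  ... | inj₂ ae = result ina inc a-compl c-compl Y Y⊆ minimalY ne ae

-- Existence of a decomposition

Has2K2 : ∀ {n} → Graph n → Set
Has2K2 G = ∃ λ a → ∃ λ b → ∃ λ c → ∃ λ d → a ~ b × c ~ d × a ≁ c × a ≁ d × b ≁ c × b ≁ d
  where open Notation G

has2K2? : ∀ {n} (G : Graph n) → Dec (Has2K2 G)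
has2K2? G = any? λ a → any? λ b → any? λ c → any? λ d →
  (adj G a b Bool.≟ true) ×-dec (adj G c d Bool.≟ true) ×-dec (adj G a c Bool.≟ false) ×-dec
  (adj G a d Bool.≟ false) ×-dec (adj G b c Bool.≟ false) ×-dec (adj G b d Bool.≟ false)

2K2⇒splitUnification : ∀ {n} (G H : Graph n) → Complementary G H → PFree G → PFree H → NoC5 G → NoC5 H →
  Has2K2 G → BySplitUnification G ⊎ BySplitUnification H
2K2⇒splitUnification {n} G H GH freeG freeH noC5G noC5H (a , b , c , d , ab , cd , ac , ad , bc , bd) =
  from-cut (shrink (cut? G) X₀ cut₀)
  where
  open Notation G
  other? : ∀ v → Dec (v ≢ a × v ≢ b × v ≢ c × v ≢ d)
  other? v = ¬? (v ≟ a) ×-dec ¬? (v ≟ b) ×-dec ¬? (v ≟ c) ×-dec ¬? (v ≟ d)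
  -- Outside `X₀` only the two edges remain, each of them a component.
  X₀ : Subset n
  X₀ = comprehension other?
  left? : ∀ v → Dec (v ≡ a ⊎ v ≡ b)
  left? v = (v ≟ a) ⊎-dec (v ≟ b)
  closed : Cutset.Closed G X₀ (comprehension left?)
  closed u v _ v∉ u∈ uv with v ≟ a | v ≟ b | v ≟ c | v ≟ d
  ... | yes e | _ | _ | _ = ∈-comprehension⁺ left? (inj₁ e)
  ... | no _ | yes e | _ | _ = ∈-comprehension⁺ left? (inj₂ e)
  ... | no _ | no _ | yes refl | _ = ⊥-elim ([ (λ { refl → true≢false uv ac }) ,
          (λ { refl → true≢false uv bc }) ]′ (∈-comprehension⁻ left? u∈))
  ... | no _ | no _ | no _ | yes refl = ⊥-elim ([ (λ { refl → true≢false uv ad }) ,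
          (λ { refl → true≢false uv bd }) ]′ (∈-comprehension⁻ left? u∈))
  ... | no p | no q | no r | no s = contradiction (∈-comprehension⁺ other? (p , q , r , s)) v∉
  cut₀ : Cut G X₀
  cut₀ = a , c ,
    ((λ i → proj₁ (∈-comprehension⁻ other? i) refl) , b , (λ i → proj₁ (proj₂ (∈-comprehension⁻ other? i)) refl) , ab) ,
    ((λ i → proj₁ (proj₂ (proj₂ (∈-comprehension⁻ other? i))) refl) , d ,
     (λ i → proj₂ (proj₂ (proj₂ (∈-comprehension⁻ other? i))) refl) , cd) ,
    comprehension left? , closed , ∈-comprehension⁺ left? (inj₁ refl) ,
    λ c∈ → [ (λ { refl → true≢false (~sym ab) bc }) , (λ { refl → true≢false ab ac }) ]′ (∈-comprehension⁻ left? c∈)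
  from-cut : (∃ λ X → X ⊆ X₀ × Cut G X × (∀ x → x ∈ X → ¬ Cut G (X - x))) →
    BySplitUnification G ⊎ BySplitUnification H
  from-cut (X , _ , (p , q , np , nq , s) , minimal)
    with any? (λ u → any? (λ w → (u ∈? X) ×-dec (w ∈? X) ×-dec ¬? (u ≟ w) ×-dec (adj G u w Bool.≟ false)))
  ... | yes (u , w , u∈ , w∈ , u≢w , uw) =
    inj₂ (InComplement.splitUnification G H GH freeG freeH noC5G noC5H X minimal np nq s u∈ w∈ u≢w uw)
  ... | no clique = inj₁ (Division.splitUnification G X freeG noC5G minimal np nq s
          λ x∈ y∈ x≢y _ _ → ¬≁⇒~ λ xy → clique (_ , _ , x∈ , y∈ , x≢y , xy))

-- 0, 2, 4, 1, 3 is a pentagon in the complement of C5.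
NoC5-compl : ∀ {n} (G H : Graph n) → Complementary G H → NoC5 G → NoC5 H
NoC5-compl {n} G H GH noC5 c hc = noC5 (c ∘ π) all
  where
  π : Fin 5 → Fin 5
  π = lookup (#0 ∷ #2 ∷ #4 ∷ #1 ∷ #3 ∷ [])
  π-inj : ∀ i j → i ≢ j → π i ≢ π j
  π-inj = from-yes (∀Fin? λ i → ∀Fin? λ j → ¬? (i ≟ j) →-dec ¬? (π i ≟ π j))
  π-adj : ∀ i j → i ≢ j → not (C5adj (π i) (π j)) ≡ C5adj i j
  π-adj = from-yes (∀Fin? λ i → ∀Fin? λ j → ¬? (i ≟ j) →-dec (not (C5adj (π i) (π j)) Bool.≟ C5adj i j))
  c-inj : ∀ i j → i ≢ j → c i ≢ c j
  c-inj i j i≢j e = C5-noTwins j i i≢j λ k _ → trans (sym (hc i k)) (trans (cong (λ v → adj H v (c k)) e) (hc j k))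
  all : IsC5 G (c ∘ π)
  all i j with i ≟ j
  ... | yes refl = trans (adjIrr G _) (sym (C5adj-irr i))
  ... | no i≢j   = trans (Complementary-sym {G = G} {H} GH (c-inj _ _ (π-inj i j i≢j)))
                     (trans (cong not (hc (π i) (π j))) (π-adj i j i≢j))

isC5? : ∀ {n} (G : Graph n) c → Dec (IsC5 G c)
isC5? G c = ∀Fin? λ i → ∀Fin? λ j → adj G (c i) (c j) Bool.≟ C5adj i j

IsC5-cong : ∀ {n} (G : Graph n) {c c′} → (∀ i → c i ≡ c′ i) → IsC5 G c → IsC5 G c′
IsC5-cong G e h i j = trans (sym (cong₂ (adj G) (e i) (e j))) (h i j)

decompose-C5-free : ∀ {n} (G : Graph n) → PFree G → NoC5 G →
  IsSplit G ⊎ (BySplitUnification G ⊎ BySplitUnification (compl G))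
decompose-C5-free G free noC5 with has2K2? G | has2K2? (compl G)
  | Complementary-sym {G = G} {compl G} (compl-adj G)
... | yes h | _ | HG = inj₂ (2K2⇒splitUnification G (compl G) (compl-adj G) free
        (PFree-compl (compl G) G HG free) noC5 (NoC5-compl G (compl G) (compl-adj G) noC5) h)
... | no _ | yes h | HG = inj₂ (swap (2K2⇒splitUnification (compl G) G HG
        (PFree-compl (compl G) G HG free) free (NoC5-compl G (compl G) (compl-adj G) noC5) noC5 h))
... | no ¬2K2 | no ¬2K2ᶜ | _ = inj₁ (foldes-hammer G
    (λ ab cd ac ad bc bd → ¬2K2 (_ , _ , _ , _ , ab , cd , ac , ad , bc , bd))
    -- The diagonals `ac` and `bd` of an induced C4 are two separated edges of the complement.
    (λ {a} {b} {c} {d} ab bc cd da ac bd a≢c b≢d → ¬2K2ᶜ (a , c , b , d , nonedge a≢c ac , nonedge b≢d bd ,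
       edge {a} {b} ab , edge {a} {d} (~sym da) , edge {c} {b} (~sym bc) , edge {c} {d} cd))
    noC5)
  where
  open Notation G
  nonedge : ∀ {u v} → u ≢ v → u ≁ v → adj (compl G) u v ≡ true
  nonedge ne e = trans (compl-adj G ne) (cong not e)
  edge : ∀ {u v} → u ~ v → adj (compl G) u v ≡ false
  edge e = trans (compl-adj G (~⇒≢ e)) (cong not e)

decompose : ∀ {n} (G : Graph n) → PFree G →
  IsSplit G ⊎ IsPentagon G ⊎ BySubstitution G ⊎ (BySplitUnification G ⊎ BySplitUnification (compl G))
decompose G free with ∃Vec? (λ v → isC5? G (lookup v))
... | yes (v , hv) = [ inj₂ ∘ inj₁ , inj₂ ∘ inj₂ ∘ inj₁ ]′ (Pentagon.fouquet G free (lookup v) hv)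
... | no none = [ inj₁ , inj₂ ∘ inj₂ ∘ inj₂ ]′ (decompose-C5-free G free
        λ c hc → none (tabulate c , IsC5-cong G (sym ∘ lookup∘tabulate c) hc))

theorem5p1 : ∀ {n : ℕ} (G : Graph n) →
    PFree G ⇔ (IsSplit G ⊎ IsPentagon G ⊎ BySubstitution G ⊎
    (BySplitUnification G ⊎ BySplitUnification (compl G)))
theorem5p1 G = mk⇔ (decompose G) λ
  { (inj₁ s)                      → split⇒PFree {G = G} s
  ; (inj₂ (inj₁ s))               → pentagon⇒PFree {G = G} s
  ; (inj₂ (inj₂ (inj₁ s)))        → subst⇒PFree {G = G} s
  ; (inj₂ (inj₂ (inj₂ (inj₁ s)))) → splitUnification⇒PFree {G = G} s
  ; (inj₂ (inj₂ (inj₂ (inj₂ s)))) → PFree-compl G (compl G) (compl-adj G) (splitUnification⇒PFree {G = compl G} s)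
  }
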